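{- $S_{\triangle}(3)=1$, $S_{\triangle}(4)=4$, $S_{\triangle}(5)=8$, $S_{\triangle}(6)=11$, $S_{\triangle}(7)=15$, $S_{\triangle}(8)=20$, and $S_{\triangle}(9)=28$.
   Context: For a finite set $P$ of points in the Euclidean plane, $S_{\triangle}(P)$ denotes the number of (unordered) triplets of points of $P$ that are the vertices of an isosceles right triangle (nondegenerate, of any size and orientation). For a positive integer $n$, $S_{\triangle}(n)=\max_{|P|=n}S_{\triangle}(P)$, the maximum being over all sets $P$ of $n$ points in the plane. -}

module Defs where

open import Algebra.Bundles using (CommutativeRing)
import Algebra.Properties.CommutativeSemigroup as CommutativeSemigroupProperties
import Algebra.Properties.Group as GroupProperties
import Algebra.Properties.Ring as RingProperties
open import Data.Fin.Base using (Fin) renaming (_<_ to _<ᶠ_)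
open import Data.List.Base using (List; length)
open import Data.List.Membership.Propositional using (_∈_)
open import Data.List.Relation.Unary.Unique.Propositional using (Unique)
open import Data.Nat.Base as ℕ using (ℕ; _⊔_)
import Data.Nat.Properties as ℕₚ
open import Data.Product.Base using (Σ-syntax; ∃-syntax; _×_; _,_)
open import Data.Product.Relation.Binary.Pointwise.NonDependent using (Pointwise)
open import Data.Rational.Base as ℚ using (ℚ; 0ℚ; 1ℚ; ½; ∣_∣; Positive; 1/_)
import Data.Rational.Properties as ℚₚ
open import Data.Sum.Base using (_⊎_)
open import Function.Bundles using (_⇔_)
open import Function.Definitions using (Injective)
open import Relation.Binary.PropositionalEquality
  using (_≡_; sym; trans; cong; cong₂; subst)
open import Relation.Nullary.Negation using (¬_)

open CommutativeSemigroupProperties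
  (CommutativeRing.+-commutativeSemigroup ℚₚ.+-*-commutativeRing) using (interchange)
open GroupProperties ℚₚ.+-0-group using (//-rightDividesˡ)
open RingProperties ℚₚ.+-*-ring using (x[y-z]≈xy-xz)

-- Equality of reals is _≃_, not _≡_.

IsCauchy : (ℕ → ℚ) → Set
IsCauchy x = ∀ ε → 0ℚ ℚ.< ε →
  ∃[ N ] (∀ m n → N ℕ.≤ m → N ℕ.≤ n → ∣ x m ℚ.- x n ∣ ℚ.< ε)

record ℝ : Set where
  constructor mkℝ
  field
    seq    : ℕ → ℚ
    cauchy : IsCauchy seq

open ℝ public

infix 4 _≃_

_≃_ : ℝ → ℝ → Set
x ≃ y = ∀ ε → 0ℚ ℚ.< ε →
  ∃[ N ] (∀ n → N ℕ.≤ n → ∣ seq x n ℚ.- seq y n ∣ ℚ.< ε)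

private abstract

  half-pos : ∀ {ε} → 0ℚ ℚ.< ε → 0ℚ ℚ.< ½ ℚ.* ε
  half-pos {ε} 0<ε =
    ℚₚ.positive⁻¹ (½ ℚ.* ε) ⦃ ℚₚ.pos*pos⇒pos ½ ε ⦃ ℚ.positive 0<ε ⦄ ⦄

  half+half : ∀ ε → ½ ℚ.* ε ℚ.+ ½ ℚ.* ε ≡ ε
  half+half ε = trans (sym (ℚₚ.*-distribʳ-+ ε ½ ½)) (ℚₚ.*-identityˡ ε)

  sum-bound : ∀ {p q ε} → ∣ p ∣ ℚ.< ½ ℚ.* ε → ∣ q ∣ ℚ.< ½ ℚ.* ε →
              ∣ p ℚ.+ q ∣ ℚ.< ε
  sum-bound {p} {q} {ε} p< q< =
    subst (∣ p ℚ.+ q ∣ ℚ.<_) (half+half ε)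
      (ℚₚ.≤-<-trans (ℚₚ.∣p+q∣≤∣p∣+∣q∣ p q) (ℚₚ.+-mono-< p< q<))

  +-cauchy : ∀ {x y} → IsCauchy x → IsCauchy y → IsCauchy (λ n → x n ℚ.+ y n)
  +-cauchy {x} {y} cx cy ε 0<ε with cx (½ ℚ.* ε) (half-pos 0<ε)
                                  | cy (½ ℚ.* ε) (half-pos 0<ε)
  ... | M , hx | N , hy = M ⊔ N , λ m n ≤m ≤n →
    subst (λ r → ∣ r ∣ ℚ.< ε) (regroup (x m) (x n) (y m) (y n))
      (sum-bound
        (hx m n (ℕₚ.m⊔n≤o⇒m≤o M N ≤m) (ℕₚ.m⊔n≤o⇒m≤o M N ≤n))
        (hy m n (ℕₚ.m⊔n≤o⇒n≤o M N ≤m) (ℕₚ.m⊔n≤o⇒n≤o M N ≤n)))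
    where
    regroup : ∀ a b c d →
      (a ℚ.- b) ℚ.+ (c ℚ.- d) ≡ (a ℚ.+ c) ℚ.- (b ℚ.+ d)
    regroup a b c d = trans (interchange a (ℚ.- b) c (ℚ.- d))
      (cong ((a ℚ.+ c) ℚ.+_) (sym (ℚₚ.neg-distrib-+ b d)))

  neg-cauchy : ∀ {x} → IsCauchy x → IsCauchy (λ n → ℚ.- x n)
  neg-cauchy {x} cx ε 0<ε with cx ε 0<ε
  ... | N , hx = N , λ m n ≤m ≤n →
    subst (ℚ._< ε)
      (trans (sym (ℚₚ.∣-p∣≡∣p∣ (x m ℚ.- x n)))
             (cong ∣_∣ (ℚₚ.neg-distrib-+ (x m) (ℚ.- x n))))
      (hx m n ≤m ≤n)

  0<1 : 0ℚ ℚ.< 1ℚ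
  0<1 = ℚₚ.positive⁻¹ 1ℚ

  eventually-bounded : ∀ {x} → IsCauchy x →
    Σ[ B ∈ ℚ ] 0ℚ ℚ.< B × ∃[ N ] (∀ n → N ℕ.≤ n → ∣ x n ∣ ℚ.< B)
  eventually-bounded {x} cx with cx 1ℚ 0<1
  ... | N , h =
      1ℚ ℚ.+ ∣ x N ∣
    , ℚₚ.+-mono-<-≤ 0<1 (ℚₚ.0≤∣p∣ (x N))
    , N
    , λ n ≤n → ℚₚ.≤-<-trans
        (subst (λ r → ∣ r ∣ ℚ.≤ ∣ x n ℚ.- x N ∣ ℚ.+ ∣ x N ∣) (//-rightDividesˡ (x N) (x n))
          (ℚₚ.∣p+q∣≤∣p∣+∣q∣ (x n ℚ.- x N) (x N)))
        (ℚₚ.+-mono-<-≤ (h n N ≤n ℕₚ.≤-refl) ℚₚ.≤-refl)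

  inverse : ∀ B → 0ℚ ℚ.< B → Σ[ C ∈ ℚ ] 0ℚ ℚ.< C × B ℚ.* C ≡ 1ℚ
  inverse B 0<B = C , ℚₚ.positive⁻¹ C ⦃ ℚₚ.1/pos⇒pos B ⦃ B-pos ⦄ ⦄
                    , ℚₚ.*-inverseʳ B ⦃ B-nonZero ⦄
    where
    B-pos : Positive B
    B-pos = ℚ.positive 0<B
    B-nonZero : ℚ.NonZero B
    B-nonZero = ℚₚ.pos⇒nonZero B ⦃ B-pos ⦄
    C : ℚ
    C = (1/ B) ⦃ B-nonZero ⦄

  product-bound : ∀ B ε → 0ℚ ℚ.< B → 0ℚ ℚ.< ε →
    Σ[ δ ∈ ℚ ] 0ℚ ℚ.< δ × (∀ p q → ∣ p ∣ ℚ.< B → ∣ q ∣ ℚ.< δ → ∣ p ℚ.* q ∣ ℚ.< ε)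
  product-bound B ε 0<B 0<ε with inverse B 0<B
  ... | C , 0<C , BC≡1 =
      C ℚ.* ε
    , ℚₚ.positive⁻¹ (C ℚ.* ε)
        ⦃ ℚₚ.pos*pos⇒pos C ⦃ ℚ.positive 0<C ⦄ ε ⦃ ℚ.positive 0<ε ⦄ ⦄
    , λ p q p< q< →
        subst (ℚ._< ε) (sym (ℚₚ.∣p*q∣≡∣p∣*∣q∣ p q))
          (ℚₚ.≤-<-trans
            (ℚₚ.*-monoʳ-≤-nonNeg ∣ q ∣ ⦃ ℚₚ.∣-∣-nonNeg q ⦄ (ℚₚ.<⇒≤ p<))
            (subst (B ℚ.* ∣ q ∣ ℚ.<_) B*C*ε≡ε
              (ℚₚ.*-monoʳ-<-pos B ⦃ ℚ.positive 0<B ⦄ q<)))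
    where
    B*C*ε≡ε : B ℚ.* (C ℚ.* ε) ≡ ε
    B*C*ε≡ε = trans (sym (ℚₚ.*-assoc B C ε))
      (trans (cong (ℚ._* ε) BC≡1) (ℚₚ.*-identityˡ ε))

  *-cauchy : ∀ {x y} → IsCauchy x → IsCauchy y → IsCauchy (λ n → x n ℚ.* y n)
  *-cauchy {x} {y} cx cy ε 0<ε
    with eventually-bounded cx | eventually-bounded cy
  ... | A , 0<A , K , x<A | B , 0<B , L , y<B
    with product-bound A (½ ℚ.* ε) 0<A (half-pos 0<ε)
       | product-bound B (½ ℚ.* ε) 0<B (half-pos 0<ε)
  ... | α , 0<α , boundA | β , 0<β , boundB
    with cx β 0<β | cy α 0<α
  ... | M , hx | N , hy = (K ⊔ L) ⊔ (M ⊔ N) , λ m n ≤m ≤n →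
    subst (λ r → ∣ r ∣ ℚ.< ε) (regroup (x m) (x n) (y m) (y n))
      (sum-bound {x m ℚ.* (y m ℚ.- y n)} {y n ℚ.* (x m ℚ.- x n)} {ε}
        (boundA (x m) (y m ℚ.- y n) (x<A m (≤K ≤m)) (hy m n (≤N ≤m) (≤N ≤n)))
        (boundB (y n) (x m ℚ.- x n) (y<B n (≤L ≤n)) (hx m n (≤M ≤m) (≤M ≤n))))
    where
    regroup : ∀ a b c d →
      a ℚ.* (c ℚ.- d) ℚ.+ d ℚ.* (a ℚ.- b) ≡ a ℚ.* c ℚ.- b ℚ.* d
    regroup a b c d = trans
      (cong₂ ℚ._+_ (x[y-z]≈xy-xz a c d)
        (trans (x[y-z]≈xy-xz d a b)
          (cong₂ ℚ._-_ (ℚₚ.*-comm d a) (ℚₚ.*-comm d b))))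
      (trans (sym (ℚₚ.+-assoc (a ℚ.* c ℚ.- a ℚ.* d) (a ℚ.* d) (ℚ.- (b ℚ.* d))))
        (cong (ℚ._- b ℚ.* d) (//-rightDividesˡ (a ℚ.* d) (a ℚ.* c))))

    ≤K : ∀ {k} → (K ⊔ L) ⊔ (M ⊔ N) ℕ.≤ k → K ℕ.≤ k
    ≤K h = ℕₚ.m⊔n≤o⇒m≤o K L (ℕₚ.m⊔n≤o⇒m≤o (K ⊔ L) (M ⊔ N) h)
    ≤L : ∀ {k} → (K ⊔ L) ⊔ (M ⊔ N) ℕ.≤ k → L ℕ.≤ k
    ≤L h = ℕₚ.m⊔n≤o⇒n≤o K L (ℕₚ.m⊔n≤o⇒m≤o (K ⊔ L) (M ⊔ N) h)
    ≤M : ∀ {k} → (K ⊔ L) ⊔ (M ⊔ N) ℕ.≤ k → M ℕ.≤ k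
    ≤M h = ℕₚ.m⊔n≤o⇒m≤o M N (ℕₚ.m⊔n≤o⇒n≤o (K ⊔ L) (M ⊔ N) h)
    ≤N : ∀ {k} → (K ⊔ L) ⊔ (M ⊔ N) ℕ.≤ k → N ℕ.≤ k
    ≤N h = ℕₚ.m⊔n≤o⇒n≤o M N (ℕₚ.m⊔n≤o⇒n≤o (K ⊔ L) (M ⊔ N) h)

fromℚ : ℚ → ℝ
fromℚ q = mkℝ (λ _ → q) λ ε 0<ε → 0 , λ _ _ _ _ →
  subst (λ r → ∣ r ∣ ℚ.< ε) (sym (ℚₚ.+-inverseʳ q)) 0<ε

0ℝ : ℝ
0ℝ = fromℚ 0ℚ

infixl 6 _+_ _-_
infixl 7 _*_
infix  8 -_

_+_ : ℝ → ℝ → ℝ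
x + y = mkℝ (λ n → seq x n ℚ.+ seq y n) (+-cauchy {seq x} {seq y} (cauchy x) (cauchy y))

-_ : ℝ → ℝ
- x = mkℝ (λ n → ℚ.- seq x n) (neg-cauchy {seq x} (cauchy x))

_-_ : ℝ → ℝ → ℝ
x - y = x + - y

_*_ : ℝ → ℝ → ℝ
x * y = mkℝ (λ n → seq x n ℚ.* seq y n) (*-cauchy {seq x} {seq y} (cauchy x) (cauchy y))

ℝ² : Set
ℝ² = ℝ × ℝ

infix 4 _≈_

_≈_ : ℝ² → ℝ² → Set
_≈_ = Pointwise _≃_ _≃_

_⟶_ : ℝ² → ℝ² → ℝ²
(x₁ , y₁) ⟶ (x₂ , y₂) = x₂ - x₁ , y₂ - y₁

dot : ℝ² → ℝ² → ℝ
dot (x₁ , y₁) (x₂ , y₂) = x₁ * x₂ + y₁ * y₂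

det : ℝ² → ℝ² → ℝ
det (x₁ , y₁) (x₂ , y₂) = x₁ * y₂ - y₁ * x₂

-- Lengths are nonnegative, so they are equal exactly when their squares are.
dist² : ℝ² → ℝ² → ℝ
dist² a b = dot (a ⟶ b) (a ⟶ b)

Collinear : ℝ² → ℝ² → ℝ² → Set
Collinear a b c = det (a ⟶ b) (a ⟶ c) ≃ 0ℝ

RightAngleAt : ℝ² → ℝ² → ℝ² → Set
RightAngleAt a b c = dot (a ⟶ b) (a ⟶ c) ≃ 0ℝ

EqualSidesAt : ℝ² → ℝ² → ℝ² → Set
EqualSidesAt a b c = dist² a b ≃ dist² a c

Right : ℝ² → ℝ² → ℝ² → Set
Right a b c = RightAngleAt a b c ⊎ RightAngleAt b c a ⊎ RightAngleAt c a b

Isosceles : ℝ² → ℝ² → ℝ² → Set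
Isosceles a b c = EqualSidesAt a b c ⊎ EqualSidesAt b c a ⊎ EqualSidesAt c a b

IsoscelesRightTriangle : ℝ² → ℝ² → ℝ² → Set
IsoscelesRightTriangle a b c = ¬ Collinear a b c × Isosceles a b c × Right a b c

-- A set of n points, enumerated without repetition.
record PointSet (n : ℕ) : Set where
  constructor mkPointSet
  field
    point    : Fin n → ℝ²
    distinct : Injective _≡_ _≈_ point

open PointSet public

Triple : ℕ → Set
Triple n = Fin n × Fin n × Fin n

-- Each unordered triplet of points has exactly one representative i < j < k.
IsTriangleOf : ∀ {n} → PointSet n → Triple n → Set
IsTriangleOf P (i , j , k) =
  i <ᶠ j × j <ᶠ k × IsoscelesRightTriangle (point P i) (point P j) (point P k)

-- The number of isosceles right triangles in P is s.  This is a relation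
-- because equality in ℝ is undecidable, so the number is not computable from P.
S△[_]≡_ : ∀ {n} → PointSet n → ℕ → Set
S△[_]≡_ {n} P s = Σ[ ts ∈ List (Triple n) ]
  Unique ts × (∀ t → t ∈ ts ⇔ IsTriangleOf P t) × length ts ≡ s

-- s is the maximum of the numbers of triangles over all sets of n points.
S△⟨_⟩≡_ : ℕ → ℕ → Set
S△⟨ n ⟩≡ s =
  (∃[ P ] S△[_]≡_ {n} P s) ×
  (∀ (P : PointSet n) s′ → S△[ P ]≡ s′ → s′ ℕ.≤ s)

module Submission where

-- Once some points of a set have Gaussian integer coordinates, every further point that
-- forms an isosceles right triangle with two of them has such coordinates too, after a
-- rescaling by 1 + i: each pair admits only six third points.  The degree of the new point
-- is at most its multiplicity among these candidates.
--
-- By the handshake lemma, deleting a point of minimal degree loses at most 3S/n of the S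
-- triangles.  A set of 9 points with 29 triangles therefore contains sets of 8, 7, 6, 5, 4
-- points with at least 20, 13, 8, 4, 2 triangles, and these can be grown point by point
-- from a single triangle.  Up to similarity only 7, 23, 17, 14, 6 such sets arise, and none
-- of those of 8 points extends to 29 triangles; the sizes of the others give the remaining
-- upper bounds.
--
-- The growth needs every new point to have positive degree.  If deleting v isolates a point
-- w, then all other points form triangles with v and w, and another point is deleted.

-- Two vertices of an isosceles right triangle determine the third by quarter turns. The only
-- denominator that arises, when the new point carries the right angle, is `1 − i`, an associate of
-- `1 + i`. This is why a single division of the unit per new point keeps all coordinates in `ℤ[i]`,
-- where equality is decidable and the growth becomes a finite computation.
--
-- The obstacle is that equality in `ℝ` is undecidable. Whether three points form a triangle is
-- therefore read off the finite list that witnesses the count, which makes degrees natural numbers.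
-- Which frame and which configuration a point set realises is known only under a double negation;
-- it can be discharged because the final conclusions are inequalities between natural numbers.
--
-- All upper bounds are proved in one induction, since they feed each other: an isolated point is
-- removed by the bound for one point fewer, and the case of a deletion that isolates a point uses
-- the bound for two points fewer.

module Counting where

  open import Data.Bool.Base using (Bool; true; false)
  open import Data.Nat.Base
  open import Data.Nat.Properties
  open import Data.Nat.Tactic.RingSolver using (solve-∀)
  open import Data.List.Base using (List; []; _∷_; length; _++_)
  open import Data.List.Membership.Propositional using (_∈_)
  open import Data.List.Membership.Propositional.Properties using (∈-∃++)
  open import Data.List.Relation.Unary.Any using (here; there)
  open import Data.List.Relation.Binary.Permutation.Propositional
    using (_↭_; ↭⇒↭ₛ; refl; prep; swap; trans; ↭-refl; ↭-sym; ↭-trans)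
  open import Data.List.Relation.Binary.Permutation.Propositional.Properties
    using (∈-resp-↭; drop-∷; shift; ↭-length)
  open import Data.Product.Base using (∃-syntax; _,_)
  open import Data.Sum.Base using (_⊎_; inj₁; inj₂)
  open import Relation.Binary.PropositionalEquality as ≡
    using (_≡_; cong; cong₂; sym; subst)
  open import Relation.Nullary.Negation using (contradiction)
  open import Relation.Nullary.Decidable.Core using (yes; no)
  open import Data.List.Relation.Unary.Unique.Propositional using (Unique)
  open import Data.List.Relation.Unary.AllPairs as AllPairs using ()
  import Data.List.Relation.Binary.Permutation.Setoid.Properties as PermutationSetoid

  -- Counting in lists and minimising over vertex deletions

  private variable A : Set

  Unique-resp-↭ : ∀ {xs ys : List A} → xs ↭ ys → Unique xs → Unique ys
  Unique-resp-↭ p = PermutationSetoid.Unique-resp-↭ (≡.setoid _) (↭⇒↭ₛ p)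

  toℕ : Bool → ℕ
  toℕ true  = 1
  toℕ false = 0

  toℕ≤1 : ∀ b → toℕ b ≤ 1
  toℕ≤1 true  = ≤-refl
  toℕ≤1 false = z≤n

  count₁ : (A → Bool) → List A → ℕ
  count₁ P []       = 0
  count₁ P (x ∷ xs) = toℕ (P x) + count₁ P xs

  count₂ : (A → A → Bool) → List A → ℕ
  count₂ R []       = 0
  count₂ R (x ∷ xs) = count₁ (R x) xs + count₂ R xs

  count₃ : (A → A → A → Bool) → List A → ℕ
  count₃ T []       = 0
  count₃ T (x ∷ xs) = count₂ (T x) xs + count₃ T xs

  exchange : ∀ a b c → a + (b + c) ≡ b + (a + c)
  exchange = solve-∀

  count₁-cong : {P Q : A → Bool} → (∀ x → P x ≡ Q x) → ∀ xs → count₁ P xs ≡ count₁ Q xs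
  count₁-cong P≗Q []       = ≡.refl
  count₁-cong P≗Q (x ∷ xs) = cong₂ _+_ (cong toℕ (P≗Q x)) (count₁-cong P≗Q xs)

  count₁-↭ : ∀ (P : A → Bool) {xs ys} → xs ↭ ys → count₁ P xs ≡ count₁ P ys
  count₁-↭ P refl         = ≡.refl
  count₁-↭ P (prep x p)   = cong (toℕ (P x) +_) (count₁-↭ P p)
  count₁-↭ P (swap {ys = ys} x y p) = ≡.trans
    (cong (λ k → toℕ (P x) + (toℕ (P y) + k)) (count₁-↭ P p))
    (exchange (toℕ (P x)) (toℕ (P y)) (count₁ P ys))
  count₁-↭ P (trans p q)  = ≡.trans (count₁-↭ P p) (count₁-↭ P q)

  count₁≤length : ∀ (P : A → Bool) xs → count₁ P xs ≤ length xs
  count₁≤length P []       = z≤n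
  count₁≤length P (x ∷ xs) = +-mono-≤ (toℕ≤1 (P x)) (count₁≤length P xs)

  -- A vertex deletion of xs is a vertex v with the list of the remaining vertices;
  -- total f xs sums f over all of them.
  total : (A → List A → ℕ) → List A → ℕ
  total f []       = 0
  total f (x ∷ xs) = f x xs + total (λ v ys → f v (x ∷ ys)) xs

  total-+ : ∀ (f g : A → List A → ℕ) xs →
            total (λ v ys → f v ys + g v ys) xs ≡ total f xs + total g xs
  total-+ f g []       = ≡.refl
  total-+ f g (x ∷ xs) = ≡.trans
    (cong (f x xs + g x xs +_) (total-+ (λ v ys → f v (x ∷ ys)) (λ v ys → g v (x ∷ ys)) xs))
    (regroup (f x xs) (g x xs) _ _)
    where
    regroup : ∀ a b c d → a + b + (c + d) ≡ (a + c) + (b + d)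
    regroup = solve-∀

  total-cong : ∀ {f g : A → List A → ℕ} → (∀ v ys → f v ys ≡ g v ys) →
               ∀ xs → total f xs ≡ total g xs
  total-cong f≗g []       = ≡.refl
  total-cong f≗g (x ∷ xs) = cong₂ _+_ (f≗g x xs) (total-cong (λ v ys → f≗g v (x ∷ ys)) xs)

  total-count₀ : ∀ (P : A → Bool) xs → total (λ v _ → toℕ (P v)) xs ≡ count₁ P xs
  total-count₀ P []       = ≡.refl
  total-count₀ P (x ∷ xs) = cong (toℕ (P x) +_) (total-count₀ P xs)

  total-count₁ : ∀ (R : A → A → Bool) → (∀ x y → R x y ≡ R y x) →
                 ∀ xs → total (λ v → count₁ (R v)) xs ≡ 2 * count₂ R xs
  total-count₁ R R-sym []       = ≡.refl
  total-count₁ R R-sym (x ∷ xs) = ≡.trans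
    (cong (count₁ (R x) xs +_) (≡.trans
      (total-+ (λ v _ → toℕ (R v x)) (λ v → count₁ (R v)) xs)
      (cong₂ _+_
        (≡.trans (total-cong (λ v _ → cong toℕ (R-sym v x)) xs) (total-count₀ (R x) xs))
        (total-count₁ R R-sym xs))))
    (regroup (count₁ (R x) xs) (count₂ R xs))
    where
    regroup : ∀ a b → a + (a + 2 * b) ≡ 2 * (a + b)
    regroup = solve-∀

  lower-total : ∀ (f : A → List A → ℕ) m xs → (∀ v ys → xs ↭ v ∷ ys → m ≤ f v ys) →
                length xs * m ≤ total f xs
  lower-total f m []       h = z≤n
  lower-total f m (x ∷ xs) h = +-mono-≤ (h x xs ↭-refl)
    (lower-total (λ v ys → f v (x ∷ ys)) m xs
      (λ v ys p → h v (x ∷ ys) (trans (prep x p) (swap x v refl))))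

  ∈⇒↭ : ∀ {v : A} {xs} → v ∈ xs → ∃[ ys ] xs ↭ v ∷ ys
  ∈⇒↭ {v = v} v∈xs with ∈-∃++ v∈xs
  ... | ys , zs , ≡.refl = ys ++ zs , shift v ys zs

  Invariant : (A → List A → ℕ) → Set _
  Invariant f = ∀ v {ys zs} → ys ↭ zs → f v ys ≡ f v zs

  -- The comparison ranges over all splittings of `xs` up to permutation, so it can be used after
  -- other points have been moved to the front. This is why `minimum` asks for `Invariant`.
  record Minimal (f : A → List A → ℕ) (xs : List A) : Set where
    constructor minimal
    field
      {vertex}  : A
      {rest}    : List A
      deletion  : xs ↭ vertex ∷ rest
      least     : ∀ w zs → xs ↭ w ∷ zs → f vertex rest ≤ f w zs

  minimum : ∀ (f : A → List A → ℕ) → Invariant f → ∀ x xs → Minimal f (x ∷ xs)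
  minimum f inv x [] = minimal ↭-refl λ w zs p → only w zs p (∈-resp-↭ (↭-sym p) (here ≡.refl))
    where
    only : ∀ w zs → x ∷ [] ↭ w ∷ zs → w ∈ x ∷ [] → f x [] ≤ f w zs
    only w zs p (here ≡.refl) = ≤-reflexive (inv x (drop-∷ p))
  minimum f inv x (y ∷ xs)
    with minimum (λ v ys → f v (x ∷ ys)) (λ v p → inv v (prep x p)) y xs
  ... | minimal {v} {ys} del least with ≤-total (f x (y ∷ xs)) (f v (x ∷ ys))
  ... | inj₁ x≤v = minimal ↭-refl λ w zs p → go w zs p (∈-resp-↭ (↭-sym p) (here ≡.refl))
    where
    go : ∀ w zs → x ∷ y ∷ xs ↭ w ∷ zs → w ∈ x ∷ y ∷ xs → f x (y ∷ xs) ≤ f w zs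
    go w zs p (here ≡.refl) = ≤-reflexive (inv x (drop-∷ p))
    go w zs p (there w∈) with ∈⇒↭ w∈
    ... | us , q = ≤-trans x≤v (≤-trans (least w us q)
      (≤-reflexive (inv w (drop-∷ (trans (swap w x refl) (trans (prep x (↭-sym q)) p))))))
  ... | inj₂ v≤x = minimal (trans (prep x del) (swap x v refl))
      λ w zs p → go w zs p (∈-resp-↭ (↭-sym p) (here ≡.refl))
    where
    go : ∀ w zs → x ∷ y ∷ xs ↭ w ∷ zs → w ∈ x ∷ y ∷ xs → f v (x ∷ ys) ≤ f w zs
    go w zs p (here ≡.refl) = ≤-trans v≤x (≤-reflexive (inv x (drop-∷ p)))
    go w zs p (there w∈) with ∈⇒↭ w∈
    ... | us , q = ≤-trans (least w us q)
      (≤-reflexive (inv w (drop-∷ (trans (swap w x refl) (trans (prep x (↭-sym q)) p)))))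

  -- Here `t` and `t′` are the thresholds for `k + 2` and `k + 3` points, and `m₁`, `m₂`, `m₃` are
  -- bounds for `k + 1`, `k + 2`, `k + 3` points. By `keep`, a minimal deletion from `t′` triangles
  -- leaves `t`: otherwise the minimal degree exceeds `gap`, too much for the fewer than `t`
  -- triangles left. By `full`, a pair that supplies everything beyond `m₁` forms a triangle with
  -- each of the `k + 1` other points. By `thin`, a set of `k + 1` points has a point of degree at
  -- most `k`. By `beyond`, a set with more than `m₃` triangles reaches `t′`.
  record Thresholds (k t t′ m₁ m₂ m₃ : ℕ) : Set where
    field
      gap     : ℕ
      t′≡     : t′ ≡ t + gap
      keep    : 3 * t < k * suc gap + 3
      full    : m₁ + suc k ≤ t′
      thin    : 3 * m₁ < suc k * suc k
      mono    : m₂ ≤ m₃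
      beyond  : t′ ≤ suc m₃

  -- Degrees and the handshake lemma

  module Triangles {A : Set} (T : A → A → A → Bool)
    (T-swap₁₂ : ∀ x y z → T x y z ≡ T y x z) (T-swap₂₃ : ∀ x y z → T x y z ≡ T x z y) where

    degree : A → List A → ℕ
    degree v = count₂ (T v)

    triangles : List A → ℕ
    triangles = count₃ T

    codegree : A → A → List A → ℕ
    codegree v w = count₁ (T v w)

    codegree-sym : ∀ v w xs → codegree v w xs ≡ codegree w v xs
    codegree-sym v w = count₁-cong (T-swap₁₂ v w)

    degree-↭ : Invariant degree
    degree-↭ v refl = ≡.refl
    degree-↭ v (prep x p) = cong₂ _+_ (count₁-↭ (T v x) p) (degree-↭ v p)
    degree-↭ v (swap {xs} {ys} x y p) = ≡.trans
      (cong₂ _+_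
        (cong₂ _+_ (cong toℕ (T-swap₂₃ v x y)) (count₁-↭ (T v x) p))
        (cong₂ _+_ (count₁-↭ (T v y) p) (degree-↭ v p)))
      (regroup (toℕ (T v y x)) (codegree v x ys) (codegree v y ys) (degree v ys))
      where
      regroup : ∀ a b c d → (a + b) + (c + d) ≡ (a + c) + (b + d)
      regroup = solve-∀
    degree-↭ v (trans p q) = ≡.trans (degree-↭ v p) (degree-↭ v q)

    triangles-↭ : ∀ {xs ys} → xs ↭ ys → triangles xs ≡ triangles ys
    triangles-↭ refl = ≡.refl
    triangles-↭ (prep x p) = cong₂ _+_ (degree-↭ x p) (triangles-↭ p)
    triangles-↭ (swap {xs} {ys} x y p) = ≡.trans
      (cong₂ _+_
        (cong₂ _+_ (≡.trans (codegree-sym x y xs) (count₁-↭ (T y x) p)) (degree-↭ x p))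
        (cong₂ _+_ (degree-↭ y p) (triangles-↭ p)))
      (regroup (codegree y x ys) (degree x ys) (degree y ys) (triangles ys))
      where
      regroup : ∀ a b c d → (a + b) + (c + d) ≡ (a + c) + (b + d)
      regroup = solve-∀
    triangles-↭ (trans p q) = ≡.trans (triangles-↭ p) (triangles-↭ q)

    -- The triangles through the first point `x` are the edges of the graph `T x` on the other
    -- points. They count once at `x` and, by the handshake lemma `total-count₁` for this graph,
    -- twice at their other ends.
    total-degree : ∀ xs → total degree xs ≡ 3 * triangles xs
    total-degree []       = ≡.refl
    total-degree (x ∷ xs) = ≡.trans
      (cong (degree x xs +_) (≡.trans
        (total-+ (λ v → codegree v x) degree xs)
        (cong₂ _+_
          (≡.trans (total-cong (λ v → codegree-sym v x) xs) (total-count₁ (T x) (T-swap₂₃ x) xs))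
          (total-degree xs))))
      (regroup (degree x xs) (triangles xs))
      where
      regroup : ∀ a b → a + (2 * a + 3 * b) ≡ 3 * (a + b)
      regroup = solve-∀

    NoIsolated : List A → Set
    NoIsolated xs = ∀ v ys → xs ↭ v ∷ ys → 1 ≤ degree v ys

    minimal-degree : ∀ n xs → length xs ≡ suc n → Minimal degree xs
    minimal-degree n (x ∷ xs) _ = minimum degree degree-↭ x xs

    -- Averaging gives `(n + 3) d ≤ 3 (d + s)` for the minimal degree `d` and the `s` triangles that
    -- survive the deletion. Cancelling `3 d` leaves a bound in terms of the survivors.
    minimal-degree-bound : ∀ {n xs} (m : Minimal degree xs) → length xs ≡ suc (suc (suc n)) →
      let open Minimal m in n * degree vertex rest ≤ 3 * triangles rest
    minimal-degree-bound {n} {xs} (minimal {v} {ys} del least) len =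
      +-cancelˡ-≤ (3 * degree v ys) _ _ (begin
        3 * degree v ys + n * degree v ys      ≡⟨ *-distribʳ-+ (degree v ys) 3 n ⟨
        (3 + n) * degree v ys                  ≡⟨ cong (_* degree v ys) len ⟨
        length xs * degree v ys                ≤⟨ lower-total degree _ xs least ⟩
        total degree xs                        ≡⟨ total-degree xs ⟩
        3 * triangles xs                       ≡⟨ cong (3 *_) (triangles-↭ del) ⟩
        3 * (degree v ys + triangles ys)       ≡⟨ *-distribˡ-+ 3 (degree v ys) (triangles ys) ⟩
        3 * degree v ys + 3 * triangles ys     ∎)
      where open ≤-Reasoning

    all-true : ∀ (P : A → Bool) xs → length xs ≤ count₁ P xs → ∀ {x} → x ∈ xs → P x ≡ true
    all-true P (x ∷ xs) h x∈ with P x in eq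
    all-true P (x ∷ xs) h       (here ≡.refl) | true  = eq
    all-true P (x ∷ xs) (s≤s h) (there x∈)    | true  = all-true P xs h x∈
    all-true P (x ∷ xs) h       x∈            | false = contradiction h (≤⇒≯ (count₁≤length P xs))

    count₁-all : ∀ (P : A → Bool) xs → (∀ {x} → x ∈ xs → P x ≡ true) → count₁ P xs ≡ length xs
    count₁-all P []       h = ≡.refl
    count₁-all P (x ∷ xs) h rewrite h (here ≡.refl) = cong suc (count₁-all P xs (λ x∈ → h (there x∈)))

    degree-positive : ∀ {v x y xs zs} → xs ↭ x ∷ y ∷ zs → T v x y ≡ true → 1 ≤ degree v xs
    degree-positive {v} p Tvxy rewrite degree-↭ v p | Tvxy = s≤s z≤n

    Bounded : ℕ → ℕ → Set
    Bounded n m = ∀ xs → length xs ≡ n → Unique xs → triangles xs ≤ m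

    Located : (ℕ → List A → Set) → ℕ → ℕ → Set
    Located Found n t =
      ∀ xs → length xs ≡ n → Unique xs → NoIsolated xs → t ≤ triangles xs → Found n xs

    -- The induction step on the number of points

    module Step (Found : ℕ → List A → Set)
      (Found-↭ : ∀ {n xs ys} → xs ↭ ys → Found n xs → Found n ys)
      {k t t′ m₁ m₂ m₃ : ℕ} (thresholds : Thresholds (suc k) t t′ m₁ m₂ m₃)
      (extend : ∀ v ys → Unique (v ∷ ys) → Found (3 + k) ys → 1 ≤ degree v ys →
                t′ ≤ triangles (v ∷ ys) → Found (4 + k) (v ∷ ys))
      (found-bounded : ∀ {xs} → Found (4 + k) xs → triangles xs ≤ m₃)
      (bounded₁ : Bounded (2 + k) m₁) (bounded₂ : Bounded (3 + k) m₂)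
      (located : Located Found (3 + k) t)
      where

      open Thresholds thresholds

      minimal-deletion-keeps : ∀ d s → suc k * d ≤ 3 * s → t′ ≤ d + s → t ≤ s
      minimal-deletion-keeps d s kd≤3s t′≤ with t ≤? s
      ... | yes t≤s = t≤s
      ... | no  t≰s = contradiction keep (≤⇒≯ (begin
          suc k * suc gap + 3 ≤⟨ +-monoˡ-≤ 3 (*-monoʳ-≤ (suc k) gap<d) ⟩
          suc k * d + 3       ≤⟨ +-monoˡ-≤ 3 kd≤3s ⟩
          3 * s + 3           ≡⟨ +-comm (3 * s) 3 ⟩
          3 + 3 * s           ≡⟨ *-suc 3 s ⟨
          3 * suc s           ≤⟨ *-monoʳ-≤ 3 (≰⇒> t≰s) ⟩
          3 * t               ∎))
        where
        open ≤-Reasoning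
        gap<d : suc gap ≤ d
        gap<d = +-cancelˡ-≤ s _ _ (begin
          s + suc gap ≡⟨ +-suc s gap ⟩
          suc s + gap ≤⟨ +-monoˡ-≤ gap (≰⇒> t≰s) ⟩
          t + gap     ≡⟨ t′≡ ⟨
          t′          ≤⟨ t′≤ ⟩
          d + s       ≡⟨ +-comm d s ⟩
          s + d       ∎)

      -- If w becomes isolated when the minimal vertex v is deleted, then every other
      -- vertex x forms a triangle with v and w, and a suitable x can be deleted instead.
      reroute : ∀ {xs v w R} → xs ↭ v ∷ w ∷ R → length R ≡ 2 + k → Unique xs →
                degree v (w ∷ R) ≤ degree w (v ∷ R) → degree w R ≡ 0 →
                t ≤ triangles R → t′ ≤ triangles xs → Found (4 + k) xs
      reroute {xs} {v} {w} {R} p len uniq dv≤dw dw≡0 t≤ t′≤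
        with minimal-degree (suc k) R len
      -- `R` has at least two points. The second one, `y`, later shows that `v` and `w` are not
      -- isolated once `x` is deleted.
      ... | minimal {x} {[]} q least =
        contradiction (≡.trans (sym len) (↭-length q)) λ ()
      ... | minimal {x} {y ∷ ys} q least = Found-↭ (↭-sym xs↭)
        (extend x ws uniq′
          (located ws (cong (2 +_) len-R′) (AllPairs.tail uniq′) no-isolated t≤ws)
          (degree-positive {x} {v} {w} {ws} {R′} ↭-refl Txvw)
          (≤-trans t′≤ (≤-reflexive (triangles-↭ xs↭))))
        where
        open ≤-Reasoning
        R′ = y ∷ ys
        ws = v ∷ w ∷ R′

        len-R′ : length R′ ≡ suc k
        len-R′ = suc-injective (≡.trans (sym (↭-length q)) len)

        xs↭ : xs ↭ x ∷ ws
        xs↭ = ↭-trans p (↭-trans (prep v (prep w q))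
          (↭-trans (prep v (swap w x refl)) (swap v x refl)))

        uniq′ : Unique (x ∷ ws)
        uniq′ = Unique-resp-↭ xs↭ uniq

        R-bounded : triangles R ≤ m₁
        R-bounded = bounded₁ R len
          (AllPairs.tail (AllPairs.tail (Unique-resp-↭ p uniq)))

        all-R : ∀ {z} → z ∈ R → T v w z ≡ true
        all-R = all-true (T v w) R (begin
          length R                                           ≡⟨ len ⟩
          2 + k                                              ≤⟨ +-cancelˡ-≤ m₁ _ _ chain ⟩
          codegree v w R                                     ∎)
          where
          -- Every triangle at `w` contains `v`, so the degree of `w` is the codegree of the pair,
          -- and it dominates the degree of `v`. As `R` holds at most `m₁` triangles, the pair
          -- supplies the rest of `t′`, which by `full` is at least the length of `R`.
          chain : m₁ + (2 + k) ≤ m₁ + codegree v w R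
          chain = begin
            m₁ + (2 + k)                                  ≤⟨ full ⟩
            t′                                            ≤⟨ t′≤ ⟩
            triangles xs                                  ≡⟨ triangles-↭ p ⟩
            degree v (w ∷ R) + (degree w R + triangles R)
              ≡⟨ cong (λ d → degree v (w ∷ R) + (d + triangles R)) dw≡0 ⟩
            degree v (w ∷ R) + triangles R                ≤⟨ +-mono-≤ dv≤dw R-bounded ⟩
            (codegree w v R + degree w R) + m₁            ≡⟨ cong (λ d → codegree w v R + d + m₁) dw≡0 ⟩
            codegree w v R + 0 + m₁                       ≡⟨ cong (_+ m₁) (+-identityʳ _) ⟩
            codegree w v R + m₁                           ≡⟨ +-comm _ m₁ ⟩
            m₁ + codegree w v R                           ≡⟨ cong (m₁ +_) (codegree-sym w v R) ⟩
            m₁ + codegree v w R                           ∎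

        all-R′ : ∀ {z} → z ∈ R′ → T v w z ≡ true
        all-R′ z∈ = all-R (∈-resp-↭ (↭-sym q) (there z∈))

        Tvwx : T v w x ≡ true
        Tvwx = all-R (∈-resp-↭ (↭-sym q) (here ≡.refl))

        cycle : ∀ a b c → T a b c ≡ T c a b
        cycle a b c = ≡.trans (T-swap₂₃ a b c) (T-swap₁₂ a c b)

        Txvw : T x v w ≡ true
        Txvw = ≡.trans (sym (cycle v w x)) Tvwx

        degree-x : degree x R′ ≤ suc k
        degree-x = s≤s⁻¹ (*-cancelˡ-< (suc (suc k)) _ _ (begin-strict
          suc (suc k) * degree x R′ ≡⟨ cong (_* degree x R′) len ⟨
          length R * degree x R′    ≤⟨ lower-total degree _ R least ⟩
          total degree R            ≡⟨ total-degree R ⟩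
          3 * triangles R           ≤⟨ *-monoʳ-≤ 3 R-bounded ⟩
          3 * m₁                    <⟨ thin ⟩
          suc (suc k) * suc (suc k) ∎))

        -- Deleting `x` costs `R` at most `suc k` triangles, and the pair `v`, `w` makes up for them
        -- by one triangle with each of the `suc k` points of `R′`.
        t≤ws : t ≤ triangles ws
        t≤ws = begin
          t                                ≤⟨ t≤ ⟩
          triangles R                      ≡⟨ triangles-↭ q ⟩
          degree x R′ + triangles R′       ≤⟨ +-monoˡ-≤ (triangles R′) degree-x ⟩
          suc k + triangles R′             ≡⟨ cong (_+ triangles R′) len-R′ ⟨
          length R′ + triangles R′         ≡⟨ cong (_+ triangles R′) (count₁-all (T v w) R′ all-R′) ⟨
          codegree v w R′ + triangles R′
            ≤⟨ +-mono-≤ (m≤m+n (codegree v w R′) (degree v R′)) (m≤n+m (triangles R′) (degree w R′)) ⟩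
          triangles ws                     ∎

        no-isolated : NoIsolated ws
        no-isolated u zs r = go (∈-resp-↭ (↭-sym r) (here ≡.refl)) r
          where
          go : ∀ {u zs} → u ∈ ws → ws ↭ u ∷ zs → 1 ≤ degree u zs
          go (here ≡.refl) r =
            degree-positive (↭-sym (drop-∷ r)) (all-R′ (here ≡.refl))
          go (there (here ≡.refl)) r =
            degree-positive (↭-sym (drop-∷ (↭-trans (swap w v refl) r)))
              (≡.trans (T-swap₁₂ w v y) (all-R′ (here ≡.refl)))
          go {u} (there (there u∈)) r with ∈⇒↭ u∈
          ... | us , s = degree-positive
            (drop-∷ (↭-trans (↭-sym r) (↭-trans (prep v (prep w s))
              (↭-trans (prep v (swap w u refl)) (swap v u refl)))))
            (≡.trans (sym (cycle v w u)) (all-R′ u∈))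

      located-step : Located Found (4 + k) t′
      located-step xs len uniq no-iso t′≤
        with minimal-degree (3 + k) xs len
      ... | m@(minimal {v} {ys} del least)
        with minimal-degree (2 + k) ys (suc-injective (≡.trans (sym (↭-length del)) len))
      ... | minimal {w} {R} del′ least′ with degree w R in dw
      -- The degree of `w` is minimal in `ys`, so its being positive excludes isolated points and
      -- `located` applies to `ys`.
      ... | suc _ = Found-↭ (↭-sym del) (extend v ys uniq′
          (located ys len-ys (AllPairs.tail uniq′)
            (λ u zs p → ≤-trans (s≤s z≤n) (least′ u zs p)) t≤ys)
          (no-iso v ys del)
          t′≤′)
        where
        uniq′ = Unique-resp-↭ del uniq
        len-ys = suc-injective (≡.trans (sym (↭-length del)) len)
        t′≤′ : t′ ≤ degree v ys + triangles ys
        t′≤′ = ≤-trans t′≤ (≤-reflexive (triangles-↭ del))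
        t≤ys : t ≤ triangles ys
        t≤ys = minimal-deletion-keeps (degree v ys) (triangles ys) (minimal-degree-bound m len) t′≤′
      ... | zero = reroute p (suc-injective (≡.trans (sym (↭-length del′)) len-ys)) uniq
          (≤-trans (≤-reflexive (sym (degree-↭ v del′)))
            (least w (v ∷ R) (↭-trans p (swap v w refl))))
          dw
          (≤-trans t≤ys (≤-reflexive (≡.trans (triangles-↭ del′) (cong (_+ triangles R) dw))))
          t′≤
        where
        p : xs ↭ v ∷ w ∷ R
        p = ↭-trans del (prep v del′)
        len-ys = suc-injective (≡.trans (sym (↭-length del)) len)
        t′≤′ : t′ ≤ degree v ys + triangles ys
        t′≤′ = ≤-trans t′≤ (≤-reflexive (triangles-↭ del))
        t≤ys : t ≤ triangles ys
        t≤ys = minimal-deletion-keeps (degree v ys) (triangles ys) (minimal-degree-bound m len) t′≤′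

      bounded-step : Bounded (4 + k) m₃
      bounded-step xs len uniq with triangles xs ≤? m₃
      ... | yes ≤m₃ = ≤m₃
      ... | no  ≰m₃ with minimal-degree (3 + k) xs len
      ... | minimal {v} {ys} del least with degree v ys in dv
      -- An isolated point lies in no triangle, so the bound for one point fewer applies. In the
      -- other case the minimal degree is positive and no point is isolated.
      ... | zero = begin
          triangles xs                ≡⟨ triangles-↭ del ⟩
          degree v ys + triangles ys  ≡⟨ cong (_+ triangles ys) dv ⟩
          triangles ys                ≤⟨ bounded₂ ys (suc-injective (≡.trans (sym (↭-length del)) len))
                                            (AllPairs.tail (Unique-resp-↭ del uniq)) ⟩
          m₂                          ≤⟨ mono ⟩
          m₃                          ∎
        where open ≤-Reasoning
      ... | suc _ = found-bounded (located-step xs len uniq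
          (λ u zs p → ≤-trans (s≤s z≤n) (least u zs p))
          (≤-trans beyond (≰⇒> ≰m₃)))

open import Defs

import Algebra.Properties.Group as GroupProperties
open import Data.Bool.Base using (Bool; true; false; _∧_; _∨_; T; if_then_else_)
open import Data.Bool.ListAction using (all; any)
open import Data.Bool.Properties using (T-∧; T-∨)
open import Data.Empty using (⊥)
open import Data.Fin.Base as Fin using (Fin)
import Data.Fin.Properties as Finₚ
open import Data.Integer.Base as ℤ using (ℤ; 0ℤ; 1ℤ; -1ℤ; +_; -[1+_])
import Data.Integer.Properties as ℤₚ
open import Data.List.Base using (List; []; _∷_; _++_; map; concatMap; filter; length; allFin)
open import Data.List.Membership.Propositional using (_∈_; find)
open import Data.List.Membership.Propositional.Properties
  using (∈-allFin; ∈-map⁺; ∈-map⁻; ∈-++⁺ˡ; ∈-++⁺ʳ; ∈-++⁻; ∈-filter⁺; ∈-filter⁻)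
import Data.List.Membership.DecPropositional as DecMembership
open import Data.List.Properties using (length-tabulate)
open import Data.List.Relation.Binary.Permutation.Propositional
  using (_↭_; prep; swap; trans; ↭-refl; ↭-sym)
open import Data.List.Relation.Binary.Permutation.Propositional.Properties using (∈-resp-↭)
open import Data.List.Relation.Binary.Pointwise using (Pointwise; []; _∷_)
open import Data.List.Relation.Unary.All as All using (All; []; _∷_)
open import Data.List.Relation.Unary.All.Properties using (all⁺)
open import Data.List.Relation.Unary.AllPairs as AllPairs using (AllPairs; []; _∷_)
import Data.List.Relation.Unary.AllPairs.Properties as AllPairsₚ
open import Data.List.Relation.Unary.Any as Any using (Any; here; there; any?)
open import Data.List.Relation.Unary.Any.Properties using (any⁻; ++⁺ˡ; ++⁺ʳ)
open import Data.List.Relation.Unary.Unique.Propositional using (Unique)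
import Data.List.Relation.Unary.Unique.Propositional.Properties as Uniqueₚ
open import Data.Maybe.Base as Maybe using (Maybe; just; nothing)
open import Data.Nat.Base as ℕ using (ℕ; zero; suc; z≤n; s≤s; _⊔_; _<ᵇ_; _≤ᵇ_)
import Data.Nat.Properties as ℕₚ
open import Data.Product.Base using (Σ-syntax; ∃-syntax; _×_; _,_; proj₁; proj₂)
open import Data.Product.Properties using (≡-dec; ,-injectiveʳ)
open import Data.Rational.Base as ℚ using (ℚ; 0ℚ; 1ℚ; ½; ∣_∣)
import Data.Rational.Properties as ℚₚ
open import Data.Rational.Solver using (module +-*-Solver)
import Data.Rational.Unnormalised.Base as ℚᵘ
import Data.Rational.Unnormalised.Properties as ℚᵘₚ
open import Data.Sum.Base as Sum using (_⊎_; inj₁; inj₂)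
open import Data.Vec.Base as Vec using (Vec; []; _∷_; lookup)
open import Function.Base using (_∘_)
open import Function.Bundles using (mk⇔; module Equivalence)
open import Relation.Binary.Bundles using (Setoid)
open import Relation.Binary.Definitions using (DecidableEquality)
open import Relation.Binary.PropositionalEquality as ≡
  using (_≡_; _≢_; refl; cong; cong₂; sym; subst; subst₂)
import Relation.Binary.Reasoning.Setoid as SetoidReasoning
open import Relation.Nullary.Decidable
  using (Dec; does; yes; no; True; toWitness; map′; ¬?; _×-dec_; _⊎-dec_; _→-dec_;
         dec-true; dec-false; does-⇔; decidable-stable)
open import Relation.Nullary.Negation using (¬_; contradiction)
open +-*-Solver using (solve; _:+_; _:*_; :-_; _:-_; con; _:=_)
open GroupProperties ℚₚ.+-0-group using (//-rightDividesˡ)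
open Counting

-- Null sequences and equality of real numbers

-- `x ≃ y` unfolds to `Null` of the difference sequence. Through `Null-resp`, a polynomial identity
-- over `ℚ`, applied termwise, turns known equalities of reals into new ones.
Null : (ℕ → ℚ) → Set
Null x = ∀ ε → 0ℚ ℚ.< ε → ∃[ N ] (∀ n → N ℕ.≤ n → ∣ x n ∣ ℚ.< ε)

*-pos : ∀ {p q} → 0ℚ ℚ.< p → 0ℚ ℚ.< q → 0ℚ ℚ.< p ℚ.* q
*-pos {p} {q} 0<p 0<q = ℚₚ.positive⁻¹ (p ℚ.* q)
  ⦃ ℚₚ.pos*pos⇒pos p ⦃ ℚ.positive 0<p ⦄ q ⦃ ℚ.positive 0<q ⦄ ⦄

0<½ : 0ℚ ℚ.< ½
0<½ = ℚₚ.positive⁻¹ ½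

½+½ : ∀ ε → ½ ℚ.* ε ℚ.+ ½ ℚ.* ε ≡ ε
½+½ = solve 1 (λ ε → con ½ :* ε :+ con ½ :* ε := ε) refl

Null-resp : ∀ {x y} → (∀ n → x n ≡ y n) → Null x → Null y
Null-resp x≗y null ε 0<ε with null ε 0<ε
... | N , h = N , λ n N≤n → subst (λ q → ∣ q ∣ ℚ.< ε) (x≗y n) (h n N≤n)

Null-dominated : ∀ {x y} → (∀ n → ∣ y n ∣ ℚ.≤ ∣ x n ∣) → Null x → Null y
Null-dominated y≤x null ε 0<ε with null ε 0<ε
... | N , h = N , λ n N≤n → ℚₚ.≤-<-trans (y≤x n) (h n N≤n)

Null-+ : ∀ {x y} → Null x → Null y → Null (λ n → x n ℚ.+ y n)
Null-+ {x} {y} nx ny ε 0<ε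
  with nx (½ ℚ.* ε) (*-pos 0<½ 0<ε) | ny (½ ℚ.* ε) (*-pos 0<½ 0<ε)
... | M , hx | N , hy = M ⊔ N , λ n ≤n →
  ℚₚ.≤-<-trans (ℚₚ.∣p+q∣≤∣p∣+∣q∣ (x n) (y n))
    (subst (∣ x n ∣ ℚ.+ ∣ y n ∣ ℚ.<_) (½+½ ε)
      (ℚₚ.+-mono-< (hx n (ℕₚ.m⊔n≤o⇒m≤o M N ≤n)) (hy n (ℕₚ.m⊔n≤o⇒n≤o M N ≤n))))

Null-neg : ∀ {x} → Null x → Null (λ n → ℚ.- x n)
Null-neg {x} = Null-dominated (λ n → ℚₚ.≤-reflexive (ℚₚ.∣-p∣≡∣p∣ (x n)))

*-mono-∣∣ : ∀ {p q B C} → ∣ p ∣ ℚ.≤ B → 0ℚ ℚ.< B → ∣ q ∣ ℚ.< C → ∣ p ℚ.* q ∣ ℚ.< B ℚ.* C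
*-mono-∣∣ {p} {q} {B} p≤B 0<B q<C =
  subst (ℚ._< _) (sym (ℚₚ.∣p*q∣≡∣p∣*∣q∣ p q))
    (ℚₚ.≤-<-trans (ℚₚ.*-monoʳ-≤-nonNeg ∣ q ∣ ⦃ ℚₚ.∣-∣-nonNeg q ⦄ p≤B)
                  (ℚₚ.*-monoʳ-<-pos B ⦃ ℚ.positive 0<B ⦄ q<C))

quotient : ∀ B ε → 0ℚ ℚ.< B → 0ℚ ℚ.< ε → Σ[ δ ∈ ℚ ] 0ℚ ℚ.< δ × B ℚ.* δ ≡ ε
quotient B ε 0<B 0<ε = 1/B ℚ.* ε , *-pos (ℚₚ.positive⁻¹ 1/B ⦃ ℚₚ.1/pos⇒pos B ⦄) 0<ε ,
  ≡.trans (sym (ℚₚ.*-assoc B 1/B ε))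
    (≡.trans (cong (ℚ._* ε) (ℚₚ.*-inverseʳ B)) (ℚₚ.*-identityˡ ε))
  where
  instance
    B-pos : ℚ.Positive B
    B-pos = ℚ.positive 0<B
    B-nonZero : ℚ.NonZero B
    B-nonZero = ℚₚ.pos⇒nonZero B
  1/B = ℚ.1/ B

p≤p+q : ∀ p {q} → 0ℚ ℚ.≤ q → p ℚ.≤ p ℚ.+ q
p≤p+q p {q} 0≤q = subst (ℚ._≤ p ℚ.+ q) (ℚₚ.+-identityʳ p) (ℚₚ.+-monoʳ-≤ p 0≤q)

∣p∣<∣q∣+ε : ∀ p q {ε} → ∣ p ℚ.- q ∣ ℚ.< ε → ∣ p ∣ ℚ.< ε ℚ.+ ∣ q ∣
∣p∣<∣q∣+ε p q h = ℚₚ.≤-<-trans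
  (subst (λ r → ∣ r ∣ ℚ.≤ ∣ p ℚ.- q ∣ ℚ.+ ∣ q ∣)
    (solve 2 (λ p q → (p :- q) :+ q := p) refl p q) (ℚₚ.∣p+q∣≤∣p∣+∣q∣ (p ℚ.- q) q))
  (ℚₚ.+-mono-<-≤ h ℚₚ.≤-refl)

Null-bounded-* : ∀ (x : ℕ → ℚ) {y : ℕ → ℚ} (B : ℚ) (M : ℕ) → 0ℚ ℚ.< B →
                 (∀ n → M ℕ.≤ n → ∣ x n ∣ ℚ.≤ B) → Null y → Null (λ n → x n ℚ.* y n)
Null-bounded-* x {y} B M 0<B x≤B ny ε 0<ε with quotient B ε 0<B 0<ε
... | δ , 0<δ , Bδ≡ε with ny δ 0<δ
... | N , hy = M ⊔ N , λ n ≤n → subst (∣ x n ℚ.* y n ∣ ℚ.<_) Bδ≡ε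
  (*-mono-∣∣ {x n} {y n} (x≤B n (ℕₚ.m⊔n≤o⇒m≤o M N ≤n)) 0<B (hy n (ℕₚ.m⊔n≤o⇒n≤o M N ≤n)))

-- A Cauchy sequence stays below `1 + ∣ x M ∣` from the index `M` on after which its terms differ by
-- less than 1.
Null-* : ∀ {x y} → IsCauchy x → Null y → Null (λ n → x n ℚ.* y n)
Null-* {x} {y} cx with cx 1ℚ (ℚₚ.positive⁻¹ 1ℚ)
... | M , hx = Null-bounded-* x {y} (1ℚ ℚ.+ ∣ x M ∣) M
  (ℚₚ.+-mono-<-≤ (ℚₚ.positive⁻¹ 1ℚ) (ℚₚ.0≤∣p∣ (x M)))
  (λ n M≤n → ℚₚ.<⇒≤ (∣p∣<∣q∣+ε (x n) (x M) (hx n M M≤n ℕₚ.≤-refl)))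

≡⇒≃ : ∀ {x y} → (∀ n → seq x n ≡ seq y n) → x ≃ y
≡⇒≃ {x} {y} x≗y ε 0<ε = 0 , λ n _ → subst (λ q → ∣ q ∣ ℚ.< ε)
  (sym (≡.trans (cong (ℚ._- seq y n) (x≗y n)) (ℚₚ.+-inverseʳ (seq y n)))) 0<ε

≃-refl : ∀ {x} → x ≃ x
≃-refl {x} = ≡⇒≃ {x} {x} (λ _ → refl)

≃-by : ∀ {x y x′ y′} → x ≃ y →
       (∀ n → seq x n ℚ.- seq y n ≡ seq x′ n ℚ.- seq y′ n) → x′ ≃ y′
≃-by x≃y h = Null-resp h x≃y

≃-by⁻ : ∀ {x y x′ y′} → x ≃ y →
        (∀ n → ℚ.- (seq x n ℚ.- seq y n) ≡ seq x′ n ℚ.- seq y′ n) → x′ ≃ y′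
≃-by⁻ {x} {y} x≃y h = Null-resp h (Null-neg {λ n → seq x n ℚ.- seq y n} x≃y)

≃-sym : ∀ {x y} → x ≃ y → y ≃ x
≃-sym {x} {y} x≃y = ≃-by⁻ {x} {y} {y} {x} x≃y λ n →
  solve 2 (λ x y → :- (x :- y) := y :- x) refl (seq x n) (seq y n)

≃-trans : ∀ {x y z} → x ≃ y → y ≃ z → x ≃ z
≃-trans {x} {y} {z} x≃y y≃z = Null-resp
  (λ n → solve 3 (λ x y z → (x :- y) :+ (y :- z) := x :- z) refl (seq x n) (seq y n) (seq z n))
  (Null-+ {λ n → seq x n ℚ.- seq y n} {λ n → seq y n ℚ.- seq z n} x≃y y≃z)

+-cong : ∀ {x y x′ y′} → x ≃ y → x′ ≃ y′ → x + x′ ≃ y + y′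
+-cong {x} {y} {x′} {y′} h h′ = Null-resp
  (λ n → solve 4 (λ x y x′ y′ → (x :- y) :+ (x′ :- y′) := (x :+ x′) :- (y :+ y′)) refl
           (seq x n) (seq y n) (seq x′ n) (seq y′ n))
  (Null-+ {λ n → seq x n ℚ.- seq y n} {λ n → seq x′ n ℚ.- seq y′ n} h h′)

-‿cong : ∀ {x y} → x ≃ y → - x ≃ - y
-‿cong {x} {y} h = ≃-by⁻ {x} {y} {(- x)} {(- y)} h λ n →
  solve 2 (λ x y → :- (x :- y) := (:- x) :- (:- y)) refl (seq x n) (seq y n)

*-congˡ : ∀ z {x y} → x ≃ y → z * x ≃ z * y
*-congˡ z {x} {y} h = Null-resp
  (λ n → solve 3 (λ x y z → z :* (x :- y) := z :* x :- z :* y) refl (seq x n) (seq y n) (seq z n))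
  (Null-* {seq z} {λ n → seq x n ℚ.- seq y n} (cauchy z) h)

*-zeroʳ : ∀ z {x} → x ≃ 0ℝ → z * x ≃ 0ℝ
*-zeroʳ z {x} h = ≃-trans {z * x} {z * 0ℝ} {0ℝ} (*-congˡ z {x} {0ℝ} h)
  (≡⇒≃ {z * 0ℝ} {0ℝ} (λ n → ℚₚ.*-zeroʳ (seq z n)))

≃0⇒Null : ∀ {x} → x ≃ 0ℝ → Null (seq x)
≃0⇒Null {x} = Null-resp (λ n → ℚₚ.+-identityʳ (seq x n))

Null⇒≃0 : ∀ {x} → Null (seq x) → x ≃ 0ℝ
Null⇒≃0 {x} = Null-resp (λ n → sym (ℚₚ.+-identityʳ (seq x n)))

-- A rational approximation of y decides whether y is small or bounded away from 0.
zero-product : ∀ {x y} → x * y ≃ 0ℝ → ¬ x ≃ 0ℝ → y ≃ 0ℝ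
zero-product {x} {y} xy≃0 x≄0 = Null⇒≃0 {y} null
  where
  null : Null (seq y)
  null ε 0<ε with cauchy y (½ ℚ.* (½ ℚ.* ε)) (*-pos 0<½ (*-pos 0<½ 0<ε))
  ... | N , near with ∣ seq y N ∣ ℚₚ.<? ½ ℚ.* ε
  ... | yes small = N , λ n N≤n → subst (∣ seq y n ∣ ℚ.<_) (½+½ ε)
    (ℚₚ.<-trans (∣p∣<∣q∣+ε (seq y n) (seq y N) (near n N N≤n ℕₚ.≤-refl))
      (ℚₚ.+-mono-≤-<
        (subst (½ ℚ.* (½ ℚ.* ε) ℚ.≤_) (½+½ (½ ℚ.* ε))
          (p≤p+q (½ ℚ.* (½ ℚ.* ε)) (ℚₚ.<⇒≤ (*-pos 0<½ (*-pos 0<½ 0<ε)))))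
        small))
  -- Now `∣ y N ∣ ≥ 2 η`, and the later terms are within `η` of `y N`, so they stay above `η`. The
  -- product can then tend to 0 only if `x` does.
  ... | no large = contradiction (Null⇒≃0 {x} x-null) x≄0
    where
    η = ½ ℚ.* (½ ℚ.* ε)
    0<η : 0ℚ ℚ.< η
    0<η = *-pos 0<½ (*-pos 0<½ 0<ε)
    η<∣y∣ : ∀ n → N ℕ.≤ n → η ℚ.< ∣ seq y n ∣
    η<∣y∣ n N≤n = ℚₚ.≰⇒> λ ∣y∣≤η → contradiction
      (ℚₚ.<-≤-trans (∣p∣<∣q∣+ε (seq y N) (seq y n) (near N n ℕₚ.≤-refl N≤n))
        (subst (η ℚ.+ ∣ seq y n ∣ ℚ.≤_) (½+½ (½ ℚ.* ε)) (ℚₚ.+-monoʳ-≤ η ∣y∣≤η)))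
      large
    x-null : Null (seq x)
    x-null δ 0<δ with ≃0⇒Null {x * y} xy≃0 (δ ℚ.* η) (*-pos 0<δ 0<η)
    ... | M , h = N ⊔ M , λ n ≤n → ℚₚ.≰⇒> λ δ≤∣x∣ →
      ℚₚ.<-irrefl refl (ℚₚ.<-≤-trans (h n (ℕₚ.m⊔n≤o⇒n≤o N M ≤n)) (subst (δ ℚ.* η ℚ.≤_)
        (sym (ℚₚ.∣p*q∣≡∣p∣*∣q∣ (seq x n) (seq y n)))
        (ℚₚ.≤-trans
          (ℚₚ.*-monoˡ-≤-nonNeg δ ⦃ ℚₚ.pos⇒nonNeg δ ⦃ ℚ.positive 0<δ ⦄ ⦄
            (ℚₚ.<⇒≤ (η<∣y∣ n (ℕₚ.m⊔n≤o⇒m≤o N M ≤n))))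
          (ℚₚ.*-monoʳ-≤-nonNeg ∣ seq y n ∣ ⦃ ℚₚ.∣-∣-nonNeg (seq y n) ⦄ δ≤∣x∣))))

∣p*p∣≡p*p : ∀ p → ∣ p ℚ.* p ∣ ≡ p ℚ.* p
∣p*p∣≡p*p p with ℚₚ.∣p∣≡p∨∣p∣≡-p p
... | inj₁ e = ≡.trans (ℚₚ.∣p*q∣≡∣p∣*∣q∣ p p) (cong₂ ℚ._*_ e e)
... | inj₂ e = ≡.trans (ℚₚ.∣p*q∣≡∣p∣*∣q∣ p p) (≡.trans (cong₂ ℚ._*_ e e)
  (solve 1 (λ p → (:- p) :* (:- p) := p :* p) refl p))

0≤p*p : ∀ p → 0ℚ ℚ.≤ p ℚ.* p
0≤p*p p = subst (0ℚ ℚ.≤_) (∣p*p∣≡p*p p) (ℚₚ.0≤∣p∣ (p ℚ.* p))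

-- From `0 ≤ x² ≤ x² + y²` the square of `x` vanishes. `zero-product` cancels a factor that is known
-- to be nonzero, so it is applied under the assumption that `x` is nonzero, which it refutes.
sum-of-squares : ∀ {x y} → x * x + y * y ≃ 0ℝ → ¬ ¬ (x ≃ 0ℝ)
sum-of-squares {x} {y} h x≄0 = x≄0 (zero-product {x} {x} x²≃0 x≄0)
  where
  x²≃0 : x * x ≃ 0ℝ
  x²≃0 = Null⇒≃0 {x * x} (Null-dominated
    {x = λ n → seq (x * x + y * y) n}
    (λ n → subst₂ (ℚ._≤_)
      (sym (∣p*p∣≡p*p (seq x n)))
      (sym (ℚₚ.0≤p⇒∣p∣≡p (ℚₚ.+-mono-≤ (0≤p*p (seq x n)) (0≤p*p (seq y n)))))
      (p≤p+q (seq x n ℚ.* seq x n) (0≤p*p (seq y n))))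
    (≃0⇒Null {x * x + y * y} h))

fromℚ-injective : ∀ {p q} → fromℚ p ≃ fromℚ q → p ≡ q
fromℚ-injective {p} {q} h with p ℚₚ.≟ q
... | yes p≡q = p≡q
-- The tolerance is the distance of `p` and `q` itself, which would have to be less than itself.
... | no  p≢q = contradiction (proj₂ (h ∣ p ℚ.- q ∣ 0<∣p-q∣) _ ℕₚ.≤-refl) (ℚₚ.<-irrefl refl)
  where
  0<∣p-q∣ : 0ℚ ℚ.< ∣ p ℚ.- q ∣
  0<∣p-q∣ = ℚₚ.≰⇒> λ ∣p-q∣≤0 → p≢q (p-q≡0⇒p≡q
    (ℚₚ.∣p∣≡0⇒p≡0 (p ℚ.- q) (ℚₚ.≤-antisym ∣p-q∣≤0 (ℚₚ.0≤∣p∣ (p ℚ.- q)))))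
    where
    p-q≡0⇒p≡q : p ℚ.- q ≡ 0ℚ → p ≡ q
    p-q≡0⇒p≡q e = ≡.trans (solve 2 (λ p q → p := (p :- q) :+ q) refl p q)
      (≡.trans (cong (ℚ._+ q) e) (ℚₚ.+-identityˡ q))

-- The plane as a module over the Gaussian integers

ι : ℤ → ℚ
ι m = m ℚ./ 1

ℚᵘ-ι : ∀ m → ℚ.toℚᵘ (ι m) ℚᵘ.≃ ℚᵘ.mkℚᵘ m 0
ℚᵘ-ι m = ℚₚ.toℚᵘ-fromℚᵘ (ℚᵘ.mkℚᵘ m 0)

ι-+ : ∀ m n → ι (m ℤ.+ n) ≡ ι m ℚ.+ ι n
ι-+ m n = ℚₚ.toℚᵘ-injective (begin
  ℚ.toℚᵘ (ι (m ℤ.+ n))              ≈⟨ ℚᵘ-ι (m ℤ.+ n) ⟩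
  ℚᵘ.mkℚᵘ (m ℤ.+ n) 0               ≈⟨ ℚᵘₚ.≃-reflexive (cong₂ (λ a b → ℚᵘ.mkℚᵘ (a ℤ.+ b) 0)
                                           (sym (ℤₚ.*-identityʳ m)) (sym (ℤₚ.*-identityʳ n))) ⟩
  ℚᵘ.mkℚᵘ m 0 ℚᵘ.+ ℚᵘ.mkℚᵘ n 0      ≈⟨ ℚᵘₚ.+-cong (ℚᵘ-ι m) (ℚᵘ-ι n) ⟨
  ℚ.toℚᵘ (ι m) ℚᵘ.+ ℚ.toℚᵘ (ι n)    ≈⟨ ℚₚ.toℚᵘ-homo-+ (ι m) (ι n) ⟨
  ℚ.toℚᵘ (ι m ℚ.+ ι n)              ∎)
  where open ℚᵘₚ.≃-Reasoning

ι-* : ∀ m n → ι (m ℤ.* n) ≡ ι m ℚ.* ι n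
ι-* m n = ℚₚ.toℚᵘ-injective (begin
  ℚ.toℚᵘ (ι (m ℤ.* n))              ≈⟨ ℚᵘ-ι (m ℤ.* n) ⟩
  ℚᵘ.mkℚᵘ m 0 ℚᵘ.* ℚᵘ.mkℚᵘ n 0      ≈⟨ ℚᵘₚ.*-cong (ℚᵘ-ι m) (ℚᵘ-ι n) ⟨
  ℚ.toℚᵘ (ι m) ℚᵘ.* ℚ.toℚᵘ (ι n)    ≈⟨ ℚₚ.toℚᵘ-homo-* (ι m) (ι n) ⟨
  ℚ.toℚᵘ (ι m ℚ.* ι n)              ∎)
  where open ℚᵘₚ.≃-Reasoning

ι-neg : ∀ m → ι (ℤ.- m) ≡ ℚ.- ι m
ι-neg m = ℚₚ.toℚᵘ-injective (begin
  ℚ.toℚᵘ (ι (ℤ.- m))                ≈⟨ ℚᵘ-ι (ℤ.- m) ⟩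
  ℚᵘ.- (ℚᵘ.mkℚᵘ m 0)                ≈⟨ ℚᵘₚ.-‿cong (ℚᵘ-ι m) ⟨
  ℚᵘ.- (ℚ.toℚᵘ (ι m))               ≈⟨ ℚₚ.toℚᵘ-homo‿- (ι m) ⟨
  ℚ.toℚᵘ (ℚ.- ι m)                  ∎)
  where open ℚᵘₚ.≃-Reasoning

ι-injective : ∀ {m n} → ι m ≡ ι n → m ≡ n
ι-injective {m} {n} e with ℚᵘₚ.≃-trans (ℚᵘₚ.≃-sym (ℚᵘ-ι m))
  (ℚᵘₚ.≃-trans (ℚᵘₚ.≃-reflexive (cong ℚ.toℚᵘ e)) (ℚᵘ-ι n))
... | ℚᵘ.*≡* m≡n = ≡.trans (sym (ℤₚ.*-identityʳ m)) (≡.trans m≡n (ℤₚ.*-identityʳ n))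

ℤ[i] : Set
ℤ[i] = ℤ × ℤ

infixl 6 _⊞_ _⊕_
infixl 7 _⊠_
infixr 7 _•_

_⊞_ _⊠_ : ℤ[i] → ℤ[i] → ℤ[i]
(a , b) ⊞ (c , d) = a ℤ.+ c , b ℤ.+ d
(a , b) ⊠ (c , d) = a ℤ.* c ℤ.- b ℤ.* d , a ℤ.* d ℤ.+ b ℤ.* c

1+i : ℤ[i]
1+i = 1ℤ , 1ℤ

2ℤ[i] : ℤ[i]
2ℤ[i] = ℤ.+ 2 , 0ℤ

-- _≈_ unfolds to differences of sequences, from which its sides cannot be inferred.
infix 4 _≋_

record _≋_ (x y : ℝ²) : Set where
  constructor ⟨_⟩
  field
    unwrap : x ≈ y

open _≋_ public

≋-refl : ∀ {x} → x ≋ x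
≋-refl {x₁ , x₂} = ⟨ ≃-refl {x₁} , ≃-refl {x₂} ⟩

≋-sym : ∀ {x y} → x ≋ y → y ≋ x
≋-sym {x₁ , x₂} {y₁ , y₂} ⟨ h₁ , h₂ ⟩ = ⟨ ≃-sym {x₁} {y₁} h₁ , ≃-sym {x₂} {y₂} h₂ ⟩

≋-trans : ∀ {x y z} → x ≋ y → y ≋ z → x ≋ z
≋-trans {x₁ , x₂} {y₁ , y₂} {z₁ , z₂} ⟨ h₁ , h₂ ⟩ ⟨ k₁ , k₂ ⟩ =
  ⟨ ≃-trans {x₁} {y₁} {z₁} h₁ k₁ , ≃-trans {x₂} {y₂} {z₂} h₂ k₂ ⟩

≡⇒≋ : ∀ {x₁ x₂ y₁ y₂} → (∀ n → seq x₁ n ≡ seq y₁ n) → (∀ n → seq x₂ n ≡ seq y₂ n) →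
      (x₁ , x₂) ≋ (y₁ , y₂)
≡⇒≋ {x₁} {x₂} {y₁} {y₂} h₁ h₂ = ⟨ ≡⇒≃ {x₁} {y₁} h₁ , ≡⇒≃ {x₂} {y₂} h₂ ⟩

opaque

  _⊕_ : ℝ² → ℝ² → ℝ²
  (x₁ , y₁) ⊕ (x₂ , y₂) = x₁ + x₂ , y₁ + y₂

  _•_ : ℤ[i] → ℝ² → ℝ²
  (a , b) • (x , y) = fromℚ (ι a) * x - fromℚ (ι b) * y , fromℚ (ι a) * y + fromℚ (ι b) * x

  ⊕-cong : ∀ {x y x′ y′} → x ≋ y → x′ ≋ y′ → x ⊕ x′ ≋ y ⊕ y′
  ⊕-cong {x₁ , x₂} {y₁ , y₂} {x₁′ , x₂′} {y₁′ , y₂′} ⟨ h₁ , h₂ ⟩ ⟨ k₁ , k₂ ⟩ =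
    ⟨ +-cong {x₁} {y₁} {x₁′} {y₁′} h₁ k₁ , +-cong {x₂} {y₂} {x₂′} {y₂′} h₂ k₂ ⟩

  •-cong : ∀ c {x y} → x ≋ y → c • x ≋ c • y
  •-cong (a , b) {x₁ , x₂} {y₁ , y₂} ⟨ h₁ , h₂ ⟩ = ⟨
    +-cong {A * x₁} {A * y₁} {(- (B * x₂))} {(- (B * y₂))} (*-congˡ A {x₁} {y₁} h₁)
      (-‿cong {B * x₂} {B * y₂} (*-congˡ B {x₂} {y₂} h₂)) ,
    +-cong {A * x₂} {A * y₂} {B * x₁} {B * y₁} (*-congˡ A {x₂} {y₂} h₂) (*-congˡ B {x₁} {y₁} h₁) ⟩
    where
    A B : ℝ
    A = fromℚ (ι a)
    B = fromℚ (ι b)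

  •-distribˡ : ∀ c x y → c • (x ⊕ y) ≋ c • x ⊕ c • y
  •-distribˡ (a , b) (x₁ , x₂) (y₁ , y₂) = ≡⇒≋
    (λ n → solve 6 (λ a b x₁ x₂ y₁ y₂ →
        a :* (x₁ :+ y₁) :- b :* (x₂ :+ y₂) := (a :* x₁ :- b :* x₂) :+ (a :* y₁ :- b :* y₂)) refl
      (ι a) (ι b) (seq x₁ n) (seq x₂ n) (seq y₁ n) (seq y₂ n))
    (λ n → solve 6 (λ a b x₁ x₂ y₁ y₂ →
        a :* (x₂ :+ y₂) :+ b :* (x₁ :+ y₁) := (a :* x₂ :+ b :* x₁) :+ (a :* y₂ :+ b :* y₁)) refl
      (ι a) (ι b) (seq x₁ n) (seq x₂ n) (seq y₁ n) (seq y₂ n))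

  •-distribʳ : ∀ c d x → (c ⊞ d) • x ≋ c • x ⊕ d • x
  •-distribʳ (a , b) (c , d) (x₁ , x₂) = ≡⇒≋
    (λ n → ≡.trans (cong₂ (λ p q → p ℚ.* seq x₁ n ℚ.- q ℚ.* seq x₂ n) (ι-+ a c) (ι-+ b d))
      (solve 6 (λ a b c d x₁ x₂ →
          (a :+ c) :* x₁ :- (b :+ d) :* x₂ := (a :* x₁ :- b :* x₂) :+ (c :* x₁ :- d :* x₂)) refl
        (ι a) (ι b) (ι c) (ι d) (seq x₁ n) (seq x₂ n)))
    (λ n → ≡.trans (cong₂ (λ p q → p ℚ.* seq x₂ n ℚ.+ q ℚ.* seq x₁ n) (ι-+ a c) (ι-+ b d))
      (solve 6 (λ a b c d x₁ x₂ →
          (a :+ c) :* x₂ :+ (b :+ d) :* x₁ := (a :* x₂ :+ b :* x₁) :+ (c :* x₂ :+ d :* x₁)) refl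
        (ι a) (ι b) (ι c) (ι d) (seq x₁ n) (seq x₂ n)))

  •-assoc : ∀ c d x → (c ⊠ d) • x ≋ c • d • x
  •-assoc (a , b) (c , d) (x₁ , x₂) = ≡⇒≋
    (λ n → ≡.trans (cong₂ (λ p q → p ℚ.* seq x₁ n ℚ.- q ℚ.* seq x₂ n) re im)
      (solve 6 (λ a b c d x₁ x₂ →
          (a :* c :- b :* d) :* x₁ :- (a :* d :+ b :* c) :* x₂ :=
          a :* (c :* x₁ :- d :* x₂) :- b :* (c :* x₂ :+ d :* x₁)) refl
        (ι a) (ι b) (ι c) (ι d) (seq x₁ n) (seq x₂ n)))
    (λ n → ≡.trans (cong₂ (λ p q → p ℚ.* seq x₂ n ℚ.+ q ℚ.* seq x₁ n) re im)
      (solve 6 (λ a b c d x₁ x₂ →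
          (a :* c :- b :* d) :* x₂ :+ (a :* d :+ b :* c) :* x₁ :=
          a :* (c :* x₂ :+ d :* x₁) :+ b :* (c :* x₁ :- d :* x₂)) refl
        (ι a) (ι b) (ι c) (ι d) (seq x₁ n) (seq x₂ n)))
    where
    re : ι (a ℤ.* c ℤ.- b ℤ.* d) ≡ ι a ℚ.* ι c ℚ.- ι b ℚ.* ι d
    re = ≡.trans (ι-+ (a ℤ.* c) (ℤ.- (b ℤ.* d)))
      (cong₂ ℚ._+_ (ι-* a c) (≡.trans (ι-neg (b ℤ.* d)) (cong ℚ.-_ (ι-* b d))))
    im : ι (a ℤ.* d ℤ.+ b ℤ.* c) ≡ ι a ℚ.* ι d ℚ.+ ι b ℚ.* ι c
    im = ≡.trans (ι-+ (a ℤ.* d) (b ℤ.* c)) (cong₂ ℚ._+_ (ι-* a d) (ι-* b c))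

  •-comm : ∀ c d x → c • d • x ≋ d • c • x
  •-comm (a , b) (c , d) (x₁ , x₂) = ≡⇒≋
    (λ n → solve 6 (λ a b c d x₁ x₂ →
        a :* (c :* x₁ :- d :* x₂) :- b :* (c :* x₂ :+ d :* x₁) :=
        c :* (a :* x₁ :- b :* x₂) :- d :* (a :* x₂ :+ b :* x₁)) refl
      (ι a) (ι b) (ι c) (ι d) (seq x₁ n) (seq x₂ n))
    (λ n → solve 6 (λ a b c d x₁ x₂ →
        a :* (c :* x₂ :+ d :* x₁) :+ b :* (c :* x₁ :- d :* x₂) :=
        c :* (a :* x₂ :+ b :* x₁) :+ d :* (a :* x₁ :- b :* x₂)) refl
      (ι a) (ι b) (ι c) (ι d) (seq x₁ n) (seq x₂ n))

  ⊕-interchange : ∀ w x y z → (w ⊕ x) ⊕ (y ⊕ z) ≋ (w ⊕ y) ⊕ (x ⊕ z)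
  ⊕-interchange (w₁ , w₂) (x₁ , x₂) (y₁ , y₂) (z₁ , z₂) =
    ≡⇒≋ (λ n → regroup (seq w₁ n) (seq x₁ n) (seq y₁ n) (seq z₁ n))
        (λ n → regroup (seq w₂ n) (seq x₂ n) (seq y₂ n) (seq z₂ n))
    where
    regroup : ∀ w x y z → (w ℚ.+ x) ℚ.+ (y ℚ.+ z) ≡ (w ℚ.+ y) ℚ.+ (x ℚ.+ z)
    regroup = solve 4 (λ w x y z → (w :+ x) :+ (y :+ z) := (w :+ y) :+ (x :+ z)) refl

  ⊕-assoc : ∀ x y z → (x ⊕ y) ⊕ z ≋ x ⊕ (y ⊕ z)
  ⊕-assoc (x₁ , x₂) (y₁ , y₂) (z₁ , z₂) =
    ≡⇒≋ (λ n → ℚₚ.+-assoc (seq x₁ n) (seq y₁ n) (seq z₁ n))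
        (λ n → ℚₚ.+-assoc (seq x₂ n) (seq y₂ n) (seq z₂ n))

  ⊕-comm : ∀ x y → x ⊕ y ≋ y ⊕ x
  ⊕-comm (x₁ , x₂) (y₁ , y₂) =
    ≡⇒≋ (λ n → ℚₚ.+-comm (seq x₁ n) (seq y₁ n)) (λ n → ℚₚ.+-comm (seq x₂ n) (seq y₂ n))

  ⊕-cancelˡ : ∀ x {y z} → x ⊕ y ≋ x ⊕ z → y ≋ z
  ⊕-cancelˡ (x₁ , x₂) {y₁ , y₂} {z₁ , z₂} ⟨ h₁ , h₂ ⟩ =
    ⟨ Null-resp (λ n → cancel (seq x₁ n) (seq y₁ n) (seq z₁ n)) h₁
    , Null-resp (λ n → cancel (seq x₂ n) (seq y₂ n) (seq z₂ n)) h₂ ⟩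
    where
    cancel : ∀ x y z → (x ℚ.+ y) ℚ.- (x ℚ.+ z) ≡ y ℚ.- z
    cancel = solve 3 (λ x y z → (x :+ y) :- (x :+ z) := y :- z) refl

  half : ℝ² → ℝ²
  half (x , y) = fromℚ ½ * x , fromℚ ½ * y

  half-cong : ∀ {x y} → x ≋ y → half x ≋ half y
  half-cong {x₁ , x₂} {y₁ , y₂} ⟨ h₁ , h₂ ⟩ =
    ⟨ *-congˡ (fromℚ ½) {x₁} {y₁} h₁ , *-congˡ (fromℚ ½) {x₂} {y₂} h₂ ⟩

  half-2• : ∀ x → half (2ℤ[i] • x) ≋ x
  half-2• (x , y) = ≡⇒≋
    (λ n → solve 2 (λ x y → con ½ :* (con (ι (ℤ.+ 2)) :* x :- con 0ℚ :* y) := x) refl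
      (seq x n) (seq y n))
    (λ n → solve 2 (λ x y → con ½ :* (con (ι (ℤ.+ 2)) :* y :+ con 0ℚ :* x) := y) refl
      (seq x n) (seq y n))

  -- The inverse of `1 + i` is `(1 − i) / 2`.
  /1+i : ℝ² → ℝ²
  /1+i u = half ((1ℤ , -1ℤ) • u)

  1+i•/1+i : ∀ u → 1+i • /1+i u ≋ u
  1+i•/1+i (x , y) = ≡⇒≋
    (λ n → solve 2 (λ x y →
        con 1ℚ :* (con ½ :* (con 1ℚ :* x :- con (ι -1ℤ) :* y)) :-
        con 1ℚ :* (con ½ :* (con 1ℚ :* y :+ con (ι -1ℤ) :* x)) := x) refl
      (seq x n) (seq y n))
    (λ n → solve 2 (λ x y →
        con 1ℚ :* (con ½ :* (con 1ℚ :* y :+ con (ι -1ℤ) :* x)) :+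
        con 1ℚ :* (con ½ :* (con 1ℚ :* x :- con (ι -1ℤ) :* y)) := y) refl
      (seq x n) (seq y n))

≡⇒• : ∀ {c d x} → c ≡ d → c • x ≋ d • x
≡⇒• refl = ≋-refl

≋-setoid : Setoid _ _
≋-setoid = record
  { Carrier = ℝ² ; _≈_ = _≋_
  ; isEquivalence = record { refl = ≋-refl ; sym = ≋-sym ; trans = ≋-trans } }

module ≋-Reasoning = SetoidReasoning ≋-setoid

-- All multipliers that have to be cancelled divide 2, so multiplying by the cofactor `d` and
-- halving inverts them.
•-cancel : ∀ c d → d ⊠ c ≡ 2ℤ[i] → ∀ {x y} → c • x ≋ c • y → x ≋ y
•-cancel c d dc≡2 {x} {y} h = ≋-trans (≋-sym (undo x)) (≋-trans (half-cong (•-cong d h)) (undo y))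
  where
  undo : ∀ z → half (d • c • z) ≋ z
  undo z = ≋-trans (half-cong (≋-trans (≋-sym (•-assoc d c z)) (≡⇒• dc≡2)))
    (half-2• z)

-- Isosceles right triangles as quarter turns

-- In complex notation `c − a = i (b − a)`: the anticlockwise quarter turn about `a` takes `b` to
-- `c`.
record Rot (a b c : ℝ²) : Set where
  constructor rotated
  field
    image : (a ⟶ c) ≈ (- proj₂ (a ⟶ b) , proj₁ (a ⟶ b))

Apex Rots : ℝ² → ℝ² → ℝ² → Set
Apex a b c = Rot a b c ⊎ Rot a c b
Rots a b c = Apex a b c ⊎ Apex b c a ⊎ Apex c a b

Rots-cycle : ∀ {a b c} → Rots a b c → Rots b c a
Rots-cycle (inj₁ h)        = inj₂ (inj₂ h)
Rots-cycle (inj₂ (inj₁ h)) = inj₁ h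
Rots-cycle (inj₂ (inj₂ h)) = inj₂ (inj₁ h)

Rots-swap : ∀ {a b c} → Rots a b c → Rots a c b
Rots-swap (inj₁ h)        = inj₁ (Sum.swap h)
Rots-swap (inj₂ (inj₁ h)) = inj₂ (inj₂ (Sum.swap h))
Rots-swap (inj₂ (inj₂ h)) = inj₂ (inj₁ (Sum.swap h))

¬¬-× : ∀ {A B : Set} → ¬ ¬ A → ¬ ¬ B → ¬ ¬ (A × B)
¬¬-× a b k = a λ x → b λ y → k (x , y)

vanish : ∀ p q → p * p + q * q ≃ 0ℝ → ¬ ¬ (p ≃ 0ℝ × q ≃ 0ℝ)
vanish p q h = ¬¬-× (sum-of-squares {p} {q} h)
  (sum-of-squares {q} {p} (≃-trans {q * q + p * p} {p * p + q * q} {0ℝ}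
    (≡⇒≃ {q * q + p * p} {p * p + q * q} (λ n → ℚₚ.+-comm (seq q n ℚ.* seq q n) (seq p n ℚ.* seq p n))) h))

-- With u = b − a and v = c − a:
-- |v − iu|² |v + iu|² = (|u|² − |v|²)² + 4 (u · v)².
apex : ∀ a b c → RightAngleAt a b c → EqualSidesAt a b c → ¬ ¬ Apex a b c
apex a@(a₁ , a₂) b@(b₁ , b₂) c@(c₁ , c₂) right equal k =
  Y≄0 (zero-product {X} {Y} XY≃0 X≄0)
  where
  u₁ = b₁ - a₁
  u₂ = b₂ - a₂
  v₁ = c₁ - a₁
  v₂ = c₂ - a₂
  -- `X` is `|v − iu|²`. `Y` is `|u − iv|²`, which equals `|v + iu|²` because
  -- `u − iv = −i (v + iu)`; in this form its vanishing is the turn that takes `c` to `b`.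
  X = (v₁ + u₂) * (v₁ + u₂) + (v₂ - u₁) * (v₂ - u₁)
  Y = (u₁ + v₂) * (u₁ + v₂) + (u₂ - v₁) * (u₂ - v₁)
  D = dist² a b - dist² a c
  E = dot (a ⟶ b) (a ⟶ c)

  D≃0 : D ≃ 0ℝ
  D≃0 = ≃-by {dist² a b} {dist² a c} {D} {0ℝ} equal λ n → sym (ℚₚ.+-identityʳ _)

  E²≃0 : fromℚ (ι (ℤ.+ 4)) * (E * E) ≃ 0ℝ
  E²≃0 = *-zeroʳ (fromℚ (ι (ℤ.+ 4))) {E * E} (*-zeroʳ E {E} right)

  XY≃0 : X * Y ≃ 0ℝ
  XY≃0 = Null-resp (λ n → identity (seq u₁ n) (seq u₂ n) (seq v₁ n) (seq v₂ n))
    (Null-+ {λ n → seq (D * D) n ℚ.- 0ℚ} {λ n → seq (fromℚ (ι (ℤ.+ 4)) * (E * E)) n ℚ.- 0ℚ}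
      (*-zeroʳ D {D} D≃0) E²≃0)
    where
    identity : ∀ u₁ u₂ v₁ v₂ →
      let X = (v₁ ℚ.+ u₂) ℚ.* (v₁ ℚ.+ u₂) ℚ.+ (v₂ ℚ.- u₁) ℚ.* (v₂ ℚ.- u₁)
          Y = (u₁ ℚ.+ v₂) ℚ.* (u₁ ℚ.+ v₂) ℚ.+ (u₂ ℚ.- v₁) ℚ.* (u₂ ℚ.- v₁)
          D = (u₁ ℚ.* u₁ ℚ.+ u₂ ℚ.* u₂) ℚ.- (v₁ ℚ.* v₁ ℚ.+ v₂ ℚ.* v₂)
          E = u₁ ℚ.* v₁ ℚ.+ u₂ ℚ.* v₂
      in (D ℚ.* D ℚ.- 0ℚ) ℚ.+ (ι (ℤ.+ 4) ℚ.* (E ℚ.* E) ℚ.- 0ℚ) ≡ X ℚ.* Y ℚ.- 0ℚ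
    identity = solve 4 (λ u₁ u₂ v₁ v₂ →
      let X = (v₁ :+ u₂) :* (v₁ :+ u₂) :+ (v₂ :- u₁) :* (v₂ :- u₁)
          Y = (u₁ :+ v₂) :* (u₁ :+ v₂) :+ (u₂ :- v₁) :* (u₂ :- v₁)
          D = (u₁ :* u₁ :+ u₂ :* u₂) :- (v₁ :* v₁ :+ v₂ :* v₂)
          E = u₁ :* v₁ :+ u₂ :* v₂
      in (D :* D :- con 0ℚ) :+ (con (ι (ℤ.+ 4)) :* (E :* E) :- con 0ℚ) := X :* Y :- con 0ℚ) refl

  X≄0 : ¬ X ≃ 0ℝ
  X≄0 X≃0 = vanish (v₁ + u₂) (v₂ - u₁) X≃0 λ (h₁ , h₂) → k (inj₁ (rotated
    ( ≃-by {v₁ + u₂} {0ℝ} {v₁} {(- u₂)} h₁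
        (λ n → solve 2 (λ v u → (v :+ u) :- con 0ℚ := v :- (:- u)) refl (seq v₁ n) (seq u₂ n))
    , ≃-by {v₂ - u₁} {0ℝ} {v₂} {u₁} h₂ (λ n → ℚₚ.+-identityʳ _))))

  Y≄0 : ¬ Y ≃ 0ℝ
  Y≄0 Y≃0 = vanish (u₁ + v₂) (u₂ - v₁) Y≃0 λ (h₁ , h₂) → k (inj₂ (rotated
    ( ≃-by {u₁ + v₂} {0ℝ} {u₁} {(- v₂)} h₁
        (λ n → solve 2 (λ v u → (v :+ u) :- con 0ℚ := v :- (:- u)) refl (seq u₁ n) (seq v₂ n))
    , ≃-by {u₂ - v₁} {0ℝ} {u₂} {v₁} h₂ (λ n → ℚₚ.+-identityʳ _))))

-- If the right angle is at a and the equal sides meet at b, then |c − a|² = 0.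
right-isosceles : ∀ a b c → ¬ Collinear a b c → RightAngleAt a b c → Isosceles a b c →
                  ¬ ¬ Apex a b c
right-isosceles a b c _ right (inj₁ equal) = apex a b c right equal
right-isosceles a@(a₁ , a₂) b@(b₁ , b₂) c@(c₁ , c₂) ¬col right (inj₂ (inj₁ equal)) _ =
  vanish (c₁ - a₁) (c₂ - a₂) ∣c-a∣²≃0 λ (h₁ , h₂) → ¬col (Null-resp
    (λ n → solve 4 (λ u₁ u₂ v₁ v₂ →
        (u₁ :* v₂ :- con 0ℚ) :+ ((:- u₂) :* v₁ :- con 0ℚ) := (u₁ :* v₂ :- u₂ :* v₁) :- con 0ℚ) refl
      (seq (b₁ - a₁) n) (seq (b₂ - a₂) n) (seq (c₁ - a₁) n) (seq (c₂ - a₂) n))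
    (Null-+ {λ n → seq ((b₁ - a₁) * (c₂ - a₂)) n ℚ.- 0ℚ} {λ n → seq ((- (b₂ - a₂)) * (c₁ - a₁)) n ℚ.- 0ℚ}
      (*-zeroʳ (b₁ - a₁) {c₂ - a₂} h₂) (*-zeroʳ (- (b₂ - a₂)) {c₁ - a₁} h₁)))
  where
  ∣c-a∣²≃0 : dist² a c ≃ 0ℝ
  -- Law of cosines: `|c − b|² = |a − b|² + |c − a|² − 2 (b − a) · (c − a)`, where the scalar
  -- product vanishes and the sides at `b` are equal.
  ∣c-a∣²≃0 = Null-resp
    (λ n → solve 6 (λ a₁ a₂ b₁ b₂ c₁ c₂ →
        (((c₁ :- b₁) :* (c₁ :- b₁) :+ (c₂ :- b₂) :* (c₂ :- b₂)) :-
         ((a₁ :- b₁) :* (a₁ :- b₁) :+ (a₂ :- b₂) :* (a₂ :- b₂))) :+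
        (con (ι (ℤ.+ 2)) :* ((b₁ :- a₁) :* (c₁ :- a₁) :+ (b₂ :- a₂) :* (c₂ :- a₂)) :- con 0ℚ) :=
        ((c₁ :- a₁) :* (c₁ :- a₁) :+ (c₂ :- a₂) :* (c₂ :- a₂)) :- con 0ℚ) refl
      (seq a₁ n) (seq a₂ n) (seq b₁ n) (seq b₂ n) (seq c₁ n) (seq c₂ n))
    (Null-+ {λ n → seq (dist² b c) n ℚ.- seq (dist² b a) n}
      {λ n → seq (fromℚ (ι (ℤ.+ 2)) * dot (a ⟶ b) (a ⟶ c)) n ℚ.- 0ℚ} equal
      (*-zeroʳ (fromℚ (ι (ℤ.+ 2))) {dot (a ⟶ b) (a ⟶ c)} right))
right-isosceles a@(a₁ , a₂) b@(b₁ , b₂) c@(c₁ , c₂) ¬col right (inj₂ (inj₂ equal)) k =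
  right-isosceles a c b ¬col′ right′ (inj₂ (inj₁ (≃-sym {dist² c a} {dist² c b} equal)))
    (λ h → k (Sum.swap h))
  where
  right′ : RightAngleAt a c b
  right′ = ≃-by {dot (a ⟶ b) (a ⟶ c)} {0ℝ} {dot (a ⟶ c) (a ⟶ b)} {0ℝ} right
    λ n → solve 4 (λ u₁ u₂ v₁ v₂ →
        (u₁ :* v₁ :+ u₂ :* v₂) :- con 0ℚ := (v₁ :* u₁ :+ v₂ :* u₂) :- con 0ℚ) refl
      (seq (b₁ - a₁) n) (seq (b₂ - a₂) n) (seq (c₁ - a₁) n) (seq (c₂ - a₂) n)
  ¬col′ : ¬ Collinear a c b
  ¬col′ col = ¬col (≃-by⁻ {det (a ⟶ c) (a ⟶ b)} {0ℝ} {det (a ⟶ b) (a ⟶ c)} {0ℝ} col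
    λ n → solve 4 (λ u₁ u₂ v₁ v₂ →
        :- ((v₁ :* u₂ :- v₂ :* u₁) :- con 0ℚ) := (u₁ :* v₂ :- u₂ :* v₁) :- con 0ℚ) refl
      (seq (b₁ - a₁) n) (seq (b₂ - a₂) n) (seq (c₁ - a₁) n) (seq (c₂ - a₂) n))

Collinear-cycle : ∀ a b c → Collinear b c a → Collinear a b c
Collinear-cycle a@(a₁ , a₂) b@(b₁ , b₂) c@(c₁ , c₂) col =
  ≃-by {det (b ⟶ c) (b ⟶ a)} {0ℝ} {det (a ⟶ b) (a ⟶ c)} {0ℝ} col λ n →
    solve 6 (λ a₁ a₂ b₁ b₂ c₁ c₂ →
        ((c₁ :- b₁) :* (a₂ :- b₂) :- (c₂ :- b₂) :* (a₁ :- b₁)) :- con 0ℚ :=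
        ((b₁ :- a₁) :* (c₂ :- a₂) :- (b₂ :- a₂) :* (c₁ :- a₁)) :- con 0ℚ) refl
      (seq a₁ n) (seq a₂ n) (seq b₁ n) (seq b₂ n) (seq c₁ n) (seq c₂ n)

Isosceles-cycle : ∀ {a b c} → Isosceles a b c → Isosceles b c a
Isosceles-cycle (inj₁ h)        = inj₂ (inj₂ h)
Isosceles-cycle (inj₂ (inj₁ h)) = inj₁ h
Isosceles-cycle (inj₂ (inj₂ h)) = inj₂ (inj₁ h)

triangle⇒rots : ∀ a b c → IsoscelesRightTriangle a b c → ¬ ¬ Rots a b c
triangle⇒rots a b c (¬col , iso , inj₁ right) k =
  right-isosceles a b c ¬col right iso λ h → k (inj₁ h)
triangle⇒rots a b c (¬col , iso , inj₂ (inj₁ right)) k =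
  right-isosceles b c a (λ col → ¬col (Collinear-cycle a b c col)) right
    (Isosceles-cycle {a} {b} {c} iso) λ h → k (inj₂ (inj₁ h))
triangle⇒rots a b c (¬col , iso , inj₂ (inj₂ right)) k =
  right-isosceles c a b
    (λ col → ¬col (Collinear-cycle a b c (Collinear-cycle b c a col))) right
    (Isosceles-cycle {b} {c} {a} (Isosceles-cycle {a} {b} {c} iso)) λ h → k (inj₂ (inj₂ h))

-- Frames with Gaussian integer coordinates

infix 4 _≟_
_≟_ : DecidableEquality ℤ[i]
_≟_ = ≡-dec ℤₚ._≟_ ℤₚ._≟_

At : ℝ² → ℝ² → ℤ[i] → ℝ² → Set
At a u c x = x ≋ a ⊕ c • u

-- Coordinates with respect to such a unit are unique, so two coordinates found for one point can be
-- identified.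
Faithful : ℝ² → Set
Faithful u = ∀ {c d} → c • u ≋ d • u → c ≡ d

-- When y and z are known, γ • v ≋ α • y ⊕ β • z determines v.  Dividing the unit
-- by 1 + i = γ ⊠ δ makes the coordinate of v integral.
record Coefficients : Set where
  constructor coefficients
  field
    α β γ δ κ : ℤ[i]
    α⊞β≡γ     : α ⊞ β ≡ γ
    γ⊠δ≡1+i   : γ ⊠ δ ≡ 1+i
    κ⊠γ≡2     : κ ⊠ γ ≡ 2ℤ[i]

  third : ℤ[i] → ℤ[i] → ℤ[i]
  third c d = (α ⊠ c ⊞ β ⊠ d) ⊠ δ

𝕚 : ℤ[i]
𝕚 = 0ℤ , 1ℤ

-- The equations `v − y = i (z − y)`, `z − y = i (v − y)` and `z − v = i (y − v)`, solved for `v`: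
-- they read `v = (1 − i) y + i z`, `i v = (−1 + i) y + z` and `(1 − i) v = −i y + z`.
anticlockwise clockwise hypotenuse : Coefficients
anticlockwise = coefficients (1ℤ , -1ℤ) (0ℤ , 1ℤ) (1ℤ , 0ℤ) (1ℤ , 1ℤ) (ℤ.+ 2 , 0ℤ) refl refl refl
clockwise     = coefficients (-1ℤ , 1ℤ) (1ℤ , 0ℤ) (0ℤ , 1ℤ) (1ℤ , -1ℤ) (0ℤ , ℤ.- (ℤ.+ 2)) refl refl refl
hypotenuse    = coefficients (0ℤ , -1ℤ) (1ℤ , 0ℤ) (1ℤ , -1ℤ) (0ℤ , 1ℤ) (1ℤ , 1ℤ) refl refl refl

Solves : Coefficients → ℝ² → ℝ² → ℝ² → Set
Solves C y z v = γ • v ≋ α • y ⊕ β • z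
  where open Coefficients C

opaque
  unfolding _•_

  anticlockwise-solves : ∀ {y z v} → Rot y z v → Solves anticlockwise y z v
  anticlockwise-solves {y₁ , y₂} {z₁ , z₂} {v₁ , v₂} (rotated (h₁ , h₂)) = ⟨
    Null-resp (λ n → solve 6 (λ y₁ y₂ z₁ z₂ v₁ v₂ →
        (v₁ :- y₁) :- (:- (z₂ :- y₂)) :=
        (con 1ℚ :* v₁ :- con 0ℚ :* v₂) :-
        ((con 1ℚ :* y₁ :- con (ι -1ℤ) :* y₂) :+ (con 0ℚ :* z₁ :- con 1ℚ :* z₂))) refl
      (seq y₁ n) (seq y₂ n) (seq z₁ n) (seq z₂ n) (seq v₁ n) (seq v₂ n)) h₁ ,
    Null-resp (λ n → solve 6 (λ y₁ y₂ z₁ z₂ v₁ v₂ →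
        (v₂ :- y₂) :- (z₁ :- y₁) :=
        (con 1ℚ :* v₂ :+ con 0ℚ :* v₁) :-
        ((con 1ℚ :* y₂ :+ con (ι -1ℤ) :* y₁) :+ (con 0ℚ :* z₂ :+ con 1ℚ :* z₁))) refl
      (seq y₁ n) (seq y₂ n) (seq z₁ n) (seq z₂ n) (seq v₁ n) (seq v₂ n)) h₂ ⟩

  clockwise-solves : ∀ {y z v} → Rot y v z → Solves clockwise y z v
  clockwise-solves {y₁ , y₂} {z₁ , z₂} {v₁ , v₂} (rotated (h₁ , h₂)) = ⟨
    Null-resp (λ n → solve 6 (λ y₁ y₂ z₁ z₂ v₁ v₂ →
        :- ((z₁ :- y₁) :- (:- (v₂ :- y₂))) :=
        (con 0ℚ :* v₁ :- con 1ℚ :* v₂) :-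
        ((con (ι -1ℤ) :* y₁ :- con 1ℚ :* y₂) :+ (con 1ℚ :* z₁ :- con 0ℚ :* z₂))) refl
      (seq y₁ n) (seq y₂ n) (seq z₁ n) (seq z₂ n) (seq v₁ n) (seq v₂ n)) (Null-neg h₁) ,
    Null-resp (λ n → solve 6 (λ y₁ y₂ z₁ z₂ v₁ v₂ →
        :- ((z₂ :- y₂) :- (v₁ :- y₁)) :=
        (con 0ℚ :* v₂ :+ con 1ℚ :* v₁) :-
        ((con (ι -1ℤ) :* y₂ :+ con 1ℚ :* y₁) :+ (con 1ℚ :* z₂ :+ con 0ℚ :* z₁))) refl
      (seq y₁ n) (seq y₂ n) (seq z₁ n) (seq z₂ n) (seq v₁ n) (seq v₂ n)) (Null-neg h₂) ⟩

  hypotenuse-solves : ∀ {y z v} → Rot v y z → Solves hypotenuse y z v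
  hypotenuse-solves {y₁ , y₂} {z₁ , z₂} {v₁ , v₂} (rotated (h₁ , h₂)) = ⟨
    Null-resp (λ n → solve 6 (λ y₁ y₂ z₁ z₂ v₁ v₂ →
        :- ((z₁ :- v₁) :- (:- (y₂ :- v₂))) :=
        (con 1ℚ :* v₁ :- con (ι -1ℤ) :* v₂) :-
        ((con 0ℚ :* y₁ :- con (ι -1ℤ) :* y₂) :+ (con 1ℚ :* z₁ :- con 0ℚ :* z₂))) refl
      (seq y₁ n) (seq y₂ n) (seq z₁ n) (seq z₂ n) (seq v₁ n) (seq v₂ n)) (Null-neg h₁) ,
    Null-resp (λ n → solve 6 (λ y₁ y₂ z₁ z₂ v₁ v₂ →
        :- ((z₂ :- v₂) :- (y₁ :- v₁)) :=
        (con 1ℚ :* v₂ :+ con (ι -1ℤ) :* v₁) :-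
        ((con 0ℚ :* y₂ :+ con (ι -1ℤ) :* y₁) :+ (con 1ℚ :* z₂ :+ con 0ℚ :* z₁))) refl
      (seq y₁ n) (seq y₂ n) (seq z₁ n) (seq z₂ n) (seq v₁ n) (seq v₂ n)) (Null-neg h₂) ⟩

  frame-origin : ∀ x y → At x (x ⟶ y) (0ℤ , 0ℤ) x
  frame-origin (x₁ , x₂) (y₁ , y₂) = ≡⇒≋
    (λ n → solve 4 (λ x₁ x₂ y₁ y₂ → x₁ :=
        x₁ :+ (con 0ℚ :* (y₁ :- x₁) :- con 0ℚ :* (y₂ :- x₂))) refl
      (seq x₁ n) (seq x₂ n) (seq y₁ n) (seq y₂ n))
    (λ n → solve 4 (λ x₁ x₂ y₁ y₂ → x₂ :=
        x₂ :+ (con 0ℚ :* (y₂ :- x₂) :+ con 0ℚ :* (y₁ :- x₁))) refl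
      (seq x₁ n) (seq x₂ n) (seq y₁ n) (seq y₂ n))

  frame-unit : ∀ x y → At x (x ⟶ y) (1ℤ , 0ℤ) y
  frame-unit (x₁ , x₂) (y₁ , y₂) = ≡⇒≋
    (λ n → solve 4 (λ x₁ x₂ y₁ y₂ → y₁ :=
        x₁ :+ (con 1ℚ :* (y₁ :- x₁) :- con 0ℚ :* (y₂ :- x₂))) refl
      (seq x₁ n) (seq x₂ n) (seq y₁ n) (seq y₂ n))
    (λ n → solve 4 (λ x₁ x₂ y₁ y₂ → y₂ :=
        x₂ :+ (con 1ℚ :* (y₂ :- x₂) :+ con 0ℚ :* (y₁ :- x₁))) refl
      (seq x₁ n) (seq x₂ n) (seq y₁ n) (seq y₂ n))

  frame-𝕚 : ∀ {x y z} → Rot x y z → At x (x ⟶ y) 𝕚 z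
  frame-𝕚 {x₁ , x₂} {y₁ , y₂} {z₁ , z₂} (rotated (h₁ , h₂)) = ⟨
    Null-resp (λ n → solve 6 (λ x₁ x₂ y₁ y₂ z₁ z₂ →
        (z₁ :- x₁) :- (:- (y₂ :- x₂)) :=
        z₁ :- (x₁ :+ (con 0ℚ :* (y₁ :- x₁) :- con 1ℚ :* (y₂ :- x₂)))) refl
      (seq x₁ n) (seq x₂ n) (seq y₁ n) (seq y₂ n) (seq z₁ n) (seq z₂ n)) h₁ ,
    Null-resp (λ n → solve 6 (λ x₁ x₂ y₁ y₂ z₁ z₂ →
        (z₂ :- x₂) :- (y₁ :- x₁) :=
        z₂ :- (x₂ :+ (con 0ℚ :* (y₂ :- x₂) :+ con 1ℚ :* (y₁ :- x₁)))) refl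
      (seq x₁ n) (seq x₂ n) (seq y₁ n) (seq y₂ n) (seq z₁ n) (seq z₂ n)) h₂ ⟩

module _ (C : Coefficients) where
  open Coefficients C

  -- Because `α ⊞ β ≡ γ`, the combination keeps the origin, multiplied by `γ`. Because
  -- `γ ⊠ δ ≡ 1+i`, the smaller unit lets `γ` be split off the coordinate as well, and then it is
  -- cancelled.
  third-at : ∀ {a u c d y z v} → At a u c y → At a u d z → Solves C y z v →
             At a (/1+i u) (third c d) v
  third-at {a} {u} {c} {d} {y} {z} {v} y≋ z≋ solves = •-cancel γ κ κ⊠γ≡2 (begin
    γ • v
      ≈⟨ solves ⟩
    α • y ⊕ β • z
      ≈⟨ ⊕-cong (•-cong α y≋) (•-cong β z≋) ⟩
    α • (a ⊕ c • u) ⊕ β • (a ⊕ d • u)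
      ≈⟨ ⊕-cong (•-distribˡ α a (c • u)) (•-distribˡ β a (d • u)) ⟩
    (α • a ⊕ α • c • u) ⊕ (β • a ⊕ β • d • u)
      ≈⟨ ⊕-interchange _ _ _ _ ⟩
    (α • a ⊕ β • a) ⊕ (α • c • u ⊕ β • d • u)
      ≈⟨ ⊕-cong (•-distribʳ α β a) (⊕-cong (•-assoc α c u) (•-assoc β d u)) ⟨
    (α ⊞ β) • a ⊕ ((α ⊠ c) • u ⊕ (β ⊠ d) • u)
      ≈⟨ ⊕-cong (≡⇒• α⊞β≡γ) (≋-sym (•-distribʳ (α ⊠ c) (β ⊠ d) u)) ⟩
    γ • a ⊕ e • u
      ≈⟨ ⊕-cong ≋-refl (•-cong e (≋-sym (1+i•/1+i u))) ⟩
    γ • a ⊕ e • 1+i • /1+i u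
      ≈⟨ ⊕-cong ≋-refl (•-cong e (≡⇒• (sym γ⊠δ≡1+i))) ⟩
    γ • a ⊕ e • (γ ⊠ δ) • /1+i u
      ≈⟨ ⊕-cong ≋-refl (•-cong e (•-assoc γ δ (/1+i u))) ⟩
    γ • a ⊕ e • γ • δ • /1+i u
      ≈⟨ ⊕-cong ≋-refl (•-comm e γ (δ • /1+i u)) ⟩
    γ • a ⊕ γ • e • δ • /1+i u
      ≈⟨ ⊕-cong ≋-refl (•-cong γ (•-assoc e δ (/1+i u))) ⟨
    γ • a ⊕ γ • (e ⊠ δ) • /1+i u
      ≈⟨ •-distribˡ γ a ((e ⊠ δ) • /1+i u) ⟨
    γ • (a ⊕ third c d • /1+i u) ∎)
    where
    open ≋-Reasoning
    e = α ⊠ c ⊞ β ⊠ d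

rescale-at : ∀ {a u c x} → At a u c x → At a (/1+i u) (c ⊠ 1+i) x
rescale-at {a} {u} {c} {x} x≋ = begin
  x                              ≈⟨ x≋ ⟩
  a ⊕ c • u                      ≈⟨ ⊕-cong ≋-refl (•-cong c (1+i•/1+i u)) ⟨
  a ⊕ c • 1+i • /1+i u           ≈⟨ ⊕-cong ≋-refl (•-assoc c 1+i (/1+i u)) ⟨
  a ⊕ (c ⊠ 1+i) • /1+i u         ∎
  where open ≋-Reasoning

-- The similarity `c ↦ α c + β` is moved from the coordinates into the frame, so that a set similar
-- to an entry of a table receives exactly the coordinates listed there.
substitute-at : ∀ {a u x} α β c → At a u (α ⊠ c ⊞ β) x → At (a ⊕ β • u) (α • u) c x
substitute-at {a} {u} {x} α β c x≋ = begin
  x                              ≈⟨ x≋ ⟩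
  a ⊕ (α ⊠ c ⊞ β) • u            ≈⟨ ⊕-cong ≋-refl (•-distribʳ (α ⊠ c) β u) ⟩
  a ⊕ ((α ⊠ c) • u ⊕ β • u)      ≈⟨ ⊕-cong ≋-refl (⊕-comm _ _) ⟩
  a ⊕ (β • u ⊕ (α ⊠ c) • u)      ≈⟨ ⊕-assoc _ _ _ ⟨
  (a ⊕ β • u) ⊕ (α ⊠ c) • u      ≈⟨ ⊕-cong ≋-refl (≋-trans (•-assoc α c u) (•-comm α c u)) ⟩
  (a ⊕ β • u) ⊕ c • α • u        ∎
  where open ≋-Reasoning

faithful-rescale : ∀ {u} → Faithful u → Faithful (/1+i u)
faithful-rescale {u} f {c} {d} h = f (begin
  c • u                  ≈⟨ •-cong c (1+i•/1+i u) ⟨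
  c • 1+i • /1+i u       ≈⟨ •-comm c 1+i (/1+i u) ⟩
  1+i • c • /1+i u       ≈⟨ •-cong 1+i h ⟩
  1+i • d • /1+i u       ≈⟨ •-comm d 1+i (/1+i u) ⟨
  d • 1+i • /1+i u       ≈⟨ •-cong d (1+i•/1+i u) ⟩
  d • u                  ∎)
  where open ≋-Reasoning

faithful-• : ∀ {u} α κ → κ ⊠ α ≡ 2ℤ[i] → Faithful u → Faithful (α • u)
faithful-• {u} α κ κ⊠α≡2 f {c} {d} h = f (•-cancel α κ κ⊠α≡2 (begin
  α • c • u    ≈⟨ •-comm α c u ⟩
  c • α • u    ≈⟨ h ⟩
  d • α • u    ≈⟨ •-comm α d u ⟨
  α • d • u    ∎))
  where open ≋-Reasoning

at-unique : ∀ {a u c d x} → Faithful u → At a u c x → At a u d x → c ≡ d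
at-unique {a} {u} f x≋c x≋d = f (⊕-cancelˡ a (≋-trans (≋-sym x≋c) x≋d))

-- If `(c − d) u` vanishes, multiplication by the conjugate of `c − d` gives `|c − d|² u ≃ 0`, with
-- `N` as `|c − d|²`. For `c ≢ d` this forces `u` to vanish, so the two points would coincide.
faithful-difference : ∀ x y → ¬ x ≈ y → Faithful (x ⟶ y)
faithful-difference x@(x₁ , x₂) y@(y₁ , y₂) x≉y {c@(c₁ , c₂)} {d@(d₁ , d₂)} h with c ≟ d
... | yes c≡d = c≡d
... | no  c≢d = contradiction
    ( ≃-by⁻ {u₁} {0ℝ} {x₁} {y₁} (u≃0 u₁ N*u₁≃0)
        (λ n → solve 2 (λ x y → :- ((y :- x) :- con 0ℚ) := x :- y) refl (seq x₁ n) (seq y₁ n))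
    , ≃-by⁻ {u₂} {0ℝ} {x₂} {y₂} (u≃0 u₂ N*u₂≃0)
        (λ n → solve 2 (λ x y → :- ((y :- x) :- con 0ℚ) := x :- y) refl (seq x₂ n) (seq y₂ n)))
    x≉y
  where
  u₁ u₂ A B N : ℝ
  u₁ = y₁ - x₁
  u₂ = y₂ - x₂
  A = fromℚ (ι c₁ ℚ.- ι d₁)
  B = fromℚ (ι c₂ ℚ.- ι d₂)
  N = A * A + B * B

  components : (A * u₁ - B * u₂ ≃ 0ℝ) × (A * u₂ + B * u₁ ≃ 0ℝ)
  components = •-components h
    where
    opaque
      unfolding _•_
      •-components : c • (u₁ , u₂) ≋ d • (u₁ , u₂) → (A * u₁ - B * u₂ ≃ 0ℝ) × (A * u₂ + B * u₁ ≃ 0ℝ)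
      •-components ⟨ h₁ , h₂ ⟩ =
        Null-resp (λ n → solve 6 (λ c₁ c₂ d₁ d₂ u₁ u₂ →
            (c₁ :* u₁ :- c₂ :* u₂) :- (d₁ :* u₁ :- d₂ :* u₂) :=
            ((c₁ :- d₁) :* u₁ :- (c₂ :- d₂) :* u₂) :- con 0ℚ) refl
          (ι c₁) (ι c₂) (ι d₁) (ι d₂) (seq u₁ n) (seq u₂ n)) h₁ ,
        Null-resp (λ n → solve 6 (λ c₁ c₂ d₁ d₂ u₁ u₂ →
            (c₁ :* u₂ :+ c₂ :* u₁) :- (d₁ :* u₂ :+ d₂ :* u₁) :=
            ((c₁ :- d₁) :* u₂ :+ (c₂ :- d₂) :* u₁) :- con 0ℚ) refl
          (ι c₁) (ι c₂) (ι d₁) (ι d₂) (seq u₁ n) (seq u₂ n)) h₂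

  P Q : ℝ
  P = A * u₁ - B * u₂
  Q = A * u₂ + B * u₁

  A*P≃0 = *-zeroʳ A {P} (proj₁ components)
  B*P≃0 = *-zeroʳ B {P} (proj₁ components)
  A*Q≃0 = *-zeroʳ A {Q} (proj₂ components)
  B*Q≃0 = *-zeroʳ B {Q} (proj₂ components)

  N*u₁≃0 : N * u₁ ≃ 0ℝ
  N*u₁≃0 = Null-resp (λ n → solve 4 (λ A B u₁ u₂ →
      (A :* (A :* u₁ :- B :* u₂) :- con 0ℚ) :+ (B :* (A :* u₂ :+ B :* u₁) :- con 0ℚ) :=
      (A :* A :+ B :* B) :* u₁ :- con 0ℚ) refl (seq A n) (seq B n) (seq u₁ n) (seq u₂ n))
    (Null-+ {λ n → seq (A * P) n ℚ.- 0ℚ} {λ n → seq (B * Q) n ℚ.- 0ℚ} A*P≃0 B*Q≃0)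

  N*u₂≃0 : N * u₂ ≃ 0ℝ
  N*u₂≃0 = Null-resp (λ n → solve 4 (λ A B u₁ u₂ →
      (A :* (A :* u₂ :+ B :* u₁) :- con 0ℚ) :+ (:- (B :* (A :* u₁ :- B :* u₂) :- con 0ℚ)) :=
      (A :* A :+ B :* B) :* u₂ :- con 0ℚ) refl (seq A n) (seq B n) (seq u₁ n) (seq u₂ n))
    (Null-+ {λ n → seq (A * Q) n ℚ.- 0ℚ} {λ n → ℚ.- (seq (B * P) n ℚ.- 0ℚ)} A*Q≃0
      (Null-neg {λ n → seq (B * P) n ℚ.- 0ℚ} B*P≃0))

  N≄0 : ¬ N ≃ 0ℝ
  N≄0 N≃0 = vanish A B N≃0 λ (A≃0 , B≃0) → c≢d (cong₂ _,_ (equal A≃0) (equal B≃0))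
    where
    equal : ∀ {m n} → fromℚ (ι m ℚ.- ι n) ≃ 0ℝ → m ≡ n
    equal {m} {n} h = ι-injective (≡.trans (sym (//-rightDividesˡ (ι n) (ι m)))
      (≡.trans (cong (ℚ._+ ι n) (fromℚ-injective {ι m ℚ.- ι n} {0ℚ} h)) (ℚₚ.+-identityˡ (ι n))))

  u≃0 : ∀ u → N * u ≃ 0ℝ → u ≃ 0ℝ
  u≃0 u h = zero-product {N} {u} h N≄0

-- The search for large configurations

record Configuration : Set where
  constructor configuration
  field
    size   : ℕ
    points : List ℤ[i]

open Configuration public

_≡ᶜ_ : ℤ[i] → ℤ[i] → Bool
c ≡ᶜ d = does (c ≟ d)

≡ᶜ⇒≡ : ∀ {c d} → T (c ≡ᶜ d) → c ≡ d
≡ᶜ⇒≡ {c} {d} h with c ≟ d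
... | yes c≡d = c≡d

multiplicity : ℤ[i] → List ℤ[i] → ℕ
multiplicity c = count₁ (c ≡ᶜ_)

thirds : ℤ[i] → ℤ[i] → List ℤ[i]
thirds c d =
  third anticlockwise c d ∷ third anticlockwise d c ∷ third clockwise c d ∷ third clockwise d c ∷
  third hypotenuse c d ∷ third hypotenuse d c ∷ []
  where open Coefficients

candidates : List ℤ[i] → List ℤ[i]
candidates []       = []
candidates (c ∷ cs) = concatMap (thirds c) cs ++ candidates cs

remove : ℤ[i] → List ℤ[i] → Maybe (List ℤ[i])
remove c []       = nothing
remove c (d ∷ ds) = if c ≡ᶜ d then just ds else Maybe.map (d ∷_) (remove c ds)

permutation? : List ℤ[i] → List ℤ[i] → Bool
permutation? []       []      = true
permutation? []       (_ ∷ _) = false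
permutation? (c ∷ cs) ds with remove c ds
... | just ds′ = permutation? cs ds′
... | nothing  = false

remove-↭ : ∀ c ds {ds′} → remove c ds ≡ just ds′ → c ∷ ds′ ↭ ds
remove-↭ c (d ∷ ds) eq with c ≟ d
remove-↭ c (d ∷ ds) refl | yes refl = ↭-refl
... | no _ with remove c ds in eq′
remove-↭ c (d ∷ ds) refl | no _ | just ds′ =
  trans (swap c d ↭-refl) (prep d (remove-↭ c ds eq′))

permutation?⇒↭ : ∀ cs ds → T (permutation? cs ds) → cs ↭ ds
permutation?⇒↭ []       []       _ = ↭-refl
permutation?⇒↭ (c ∷ cs) ds       h with remove c ds in eq
... | just ds′ = trans (prep c (permutation?⇒↭ cs ds′ h)) (remove-↭ c ds eq)

infixl 6 _⊓_ _⊟_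

_⊓_ _⊟_ : ℤ[i] → ℤ[i] → ℤ[i]
(a , b) ⊓ (c , d) = a ℤ.⊓ c , b ℤ.⊓ d
(a , b) ⊟ (c , d) = a ℤ.- c , b ℤ.- d

corner : List ℤ[i] → ℤ[i]
corner []           = 0ℤ , 0ℤ
corner (c ∷ [])     = c
corner (c ∷ d ∷ cs) = c ⊓ corner (d ∷ cs)

record Factor : Set where
  constructor factor
  field
    α κ   : ℤ[i]
    κ⊠α≡2 : κ ⊠ α ≡ 2ℤ[i]

-- A rescaled configuration with its new point has at most one common factor 1 + i.
factors : List Factor
factors =
  factor (1ℤ , 0ℤ)   (+ 2 , 0ℤ)     refl ∷ factor (0ℤ , 1ℤ)   (0ℤ , -[1+ 1 ]) refl ∷
  factor (-1ℤ , 0ℤ)  (-[1+ 1 ] , 0ℤ) refl ∷ factor (0ℤ , -1ℤ)  (0ℤ , + 2)      refl ∷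
  factor (1ℤ , 1ℤ)   (1ℤ , -1ℤ)     refl ∷ factor (-1ℤ , 1ℤ)  (-1ℤ , -1ℤ)     refl ∷
  factor (-1ℤ , -1ℤ) (-1ℤ , 1ℤ)     refl ∷ factor (1ℤ , -1ℤ)  (1ℤ , 1ℤ)       refl ∷ []

transform : ℤ[i] → ℤ[i] → List ℤ[i] → List ℤ[i]
transform α β = map (λ c → α ⊠ c ⊞ β)

record Similar (cs ds : List ℤ[i]) : Set where
  constructor similar
  field
    ratio       : Factor
    translation : ℤ[i]
    image       : transform (Factor.α ratio) translation cs ↭ ds

-- A translation that maps one set to another also maps the one corner to the other.
aligned? : List ℤ[i] → List ℤ[i] → Factor → Bool
aligned? cs ds (factor α _ _) =
  permutation? (transform α (corner ds ⊟ corner (map (α ⊠_) cs)) cs) ds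

similar? : List ℤ[i] → List ℤ[i] → Bool
similar? cs ds = any (aligned? cs ds) factors

similar?⇒Similar : ∀ cs ds → T (similar? cs ds) → Similar cs ds
similar?⇒Similar cs ds h with Any.satisfied (any⁻ (aligned? cs ds) factors h)
... | f@(factor α _ _) , p = similar f (corner ds ⊟ corner (map (α ⊠_) cs)) (permutation?⇒↭ _ ds p)

-- The new point d occurs as a candidate once for every triangle it completes.
accepts : ℕ → List Configuration → ℕ → List ℤ[i] → List ℤ[i] → Bool
accepts t next s cs []       = true
accepts t next s cs (d ∷ ds) = accepted (s ℕ.+ suc (multiplicity d ds)) ∧ accepts t next s cs ds
  where
  accepted : ℕ → Bool
  accepted s′ = (s′ <ᵇ t) ∨ (any (d ≡ᶜ_) cs ∨
    any (λ C → (s′ ≤ᵇ size C) ∧ similar? (points C) (d ∷ cs)) next)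

-- The candidates refer to the unit divided by `1 + i`, so the old coordinates are multiplied by
-- `1 + i` to match.
covers : ℕ → List Configuration → Configuration → Bool
covers t next C = accepts t next (size C) (map (_⊠ 1+i) (points C)) (candidates (points C))

Extends : List Configuration → ℕ → List ℤ[i] → Set
Extends next s cs = Any (λ C → s ℕ.≤ size C × Similar (points C) cs) next

-- The induction runs to the first occurrence of `c` in `ds`, where the number tested is the full
-- multiplicity. Later occurrences are tested with smaller numbers, which is a weaker requirement.
accepts-sound : ∀ t next s cs ds → T (accepts t next s cs ds) →
  ∀ c → 1 ℕ.≤ multiplicity c ds → t ℕ.≤ s ℕ.+ multiplicity c ds →
  c ∈ cs ⊎ Extends next (s ℕ.+ multiplicity c ds) (c ∷ cs)
accepts-sound t next s cs (d ∷ ds) h c = go (c ≟ d)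
  where
  Goal : ℕ → Set
  Goal m = 1 ℕ.≤ m → t ℕ.≤ s ℕ.+ m → c ∈ cs ⊎ Extends next (s ℕ.+ m) (c ∷ cs)

  m : ℕ
  m = suc (multiplicity d ds)

  extends : ∀ {C} → T ((s ℕ.+ m ≤ᵇ size C) ∧ similar? (points C) (d ∷ cs)) →
            s ℕ.+ m ℕ.≤ size C × Similar (points C) (d ∷ cs)
  extends {C} h with Equivalence.to T-∧ h
  ... | size≤ , sim = ℕₚ.≤ᵇ⇒≤ _ (size C) size≤ , similar?⇒Similar (points C) (d ∷ cs) sim

  first : t ℕ.≤ s ℕ.+ m → d ∈ cs ⊎ Extends next (s ℕ.+ m) (d ∷ cs)
  first t≤ with Equivalence.to T-∨ (proj₁ (Equivalence.to T-∧ h))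
  ... | inj₁ small = contradiction (ℕₚ.<ᵇ⇒< _ t small) (ℕₚ.≤⇒≯ t≤)
  ... | inj₂ h′ with Equivalence.to T-∨ h′
  ... | inj₁ old = inj₁ (Any.map ≡ᶜ⇒≡ (any⁻ _ cs old))
  ... | inj₂ new = inj₂ (Any.map (λ {C} → extends {C}) (any⁻ _ next new))

  go : Dec (c ≡ d) → Goal (multiplicity c (d ∷ ds))
  go (yes refl) = subst Goal
    (cong (λ b → toℕ b ℕ.+ multiplicity c ds) (sym (dec-true (c ≟ c) refl))) (λ _ → first)
  go (no c≢d)     = subst Goal
    (cong (λ b → toℕ b ℕ.+ multiplicity c ds) (sym (dec-false (c ≟ d) c≢d)))
    (accepts-sound t next s cs ds (proj₂ (Equivalence.to T-∧ h)) c)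

-- Tables of configurations and their verification

config : ℕ → List (ℕ × ℕ) → Configuration
config s cs = configuration s (map (λ (x , y) → + x , + y) cs)

table₃ : List Configuration
table₃ = config 1 ((0 , 0) ∷ (1 , 0) ∷ (0 , 1) ∷ []) ∷ []

-- The similarities tested preserve orientation, so a set without mirror symmetry and its mirror
-- image are separate entries.
table₄ : List Configuration
table₄ =
  config 4 ((0 , 0) ∷ (0 , 1) ∷ (1 , 0) ∷ (1 , 1) ∷ []) ∷
  config 3 ((0 , 0) ∷ (0 , 1) ∷ (0 , 2) ∷ (1 , 1) ∷ []) ∷
  config 2 ((0 , 0) ∷ (0 , 1) ∷ (1 , 0) ∷ (1 , 2) ∷ []) ∷
  config 2 ((0 , 0) ∷ (0 , 1) ∷ (1 , 0) ∷ (2 , 1) ∷ []) ∷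
  config 2 ((0 , 0) ∷ (0 , 1) ∷ (1 , 1) ∷ (1 , 2) ∷ []) ∷
  config 2 ((0 , 0) ∷ (1 , 0) ∷ (1 , 1) ∷ (2 , 1) ∷ []) ∷ []

table₅ : List Configuration
table₅ =
  config 8 ((0 , 1) ∷ (1 , 0) ∷ (1 , 1) ∷ (1 , 2) ∷ (2 , 1) ∷ []) ∷
  config 6 ((0 , 0) ∷ (0 , 1) ∷ (0 , 2) ∷ (1 , 0) ∷ (1 , 1) ∷ []) ∷
  config 6 ((0 , 0) ∷ (0 , 1) ∷ (0 , 2) ∷ (1 , 1) ∷ (1 , 2) ∷ []) ∷
  config 5 ((0 , 0) ∷ (0 , 1) ∷ (0 , 2) ∷ (1 , 1) ∷ (2 , 0) ∷ []) ∷
  config 5 ((0 , 0) ∷ (0 , 1) ∷ (0 , 2) ∷ (1 , 1) ∷ (2 , 2) ∷ []) ∷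
  config 5 ((0 , 0) ∷ (0 , 1) ∷ (1 , 0) ∷ (1 , 2) ∷ (2 , 1) ∷ []) ∷
  config 4 ((0 , 0) ∷ (0 , 1) ∷ (0 , 2) ∷ (1 , 1) ∷ (1 , 3) ∷ []) ∷
  config 4 ((0 , 0) ∷ (0 , 1) ∷ (1 , 1) ∷ (1 , 2) ∷ (2 , 1) ∷ []) ∷
  config 4 ((0 , 0) ∷ (0 , 1) ∷ (1 , 1) ∷ (2 , 0) ∷ (2 , 2) ∷ []) ∷
  config 4 ((0 , 0) ∷ (0 , 2) ∷ (1 , 0) ∷ (1 , 1) ∷ (2 , 2) ∷ []) ∷
  config 4 ((0 , 0) ∷ (0 , 2) ∷ (1 , 2) ∷ (1 , 3) ∷ (2 , 2) ∷ []) ∷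
  config 4 ((0 , 0) ∷ (1 , 0) ∷ (1 , 1) ∷ (1 , 2) ∷ (2 , 1) ∷ []) ∷
  config 4 ((0 , 0) ∷ (1 , 0) ∷ (1 , 1) ∷ (2 , 0) ∷ (3 , 1) ∷ []) ∷
  config 4 ((0 , 0) ∷ (2 , 0) ∷ (2 , 1) ∷ (2 , 2) ∷ (3 , 1) ∷ []) ∷ []

table₆ : List Configuration
table₆ =
  config 11 ((0 , 0) ∷ (0 , 1) ∷ (1 , 0) ∷ (1 , 1) ∷ (1 , 2) ∷ (2 , 1) ∷ []) ∷
  config 10 ((0 , 0) ∷ (0 , 1) ∷ (0 , 2) ∷ (1 , 0) ∷ (1 , 1) ∷ (1 , 2) ∷ []) ∷
  config 10 ((0 , 0) ∷ (0 , 1) ∷ (0 , 2) ∷ (1 , 1) ∷ (2 , 0) ∷ (2 , 2) ∷ []) ∷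
  config 10 ((0 , 0) ∷ (0 , 2) ∷ (1 , 1) ∷ (1 , 2) ∷ (1 , 3) ∷ (2 , 2) ∷ []) ∷
  config 10 ((0 , 0) ∷ (1 , 1) ∷ (2 , 0) ∷ (2 , 1) ∷ (2 , 2) ∷ (3 , 1) ∷ []) ∷
  config 9 ((0 , 0) ∷ (0 , 1) ∷ (0 , 2) ∷ (1 , 0) ∷ (1 , 1) ∷ (2 , 0) ∷ []) ∷
  config 8 ((0 , 0) ∷ (0 , 1) ∷ (0 , 2) ∷ (0 , 3) ∷ (1 , 1) ∷ (1 , 2) ∷ []) ∷
  config 8 ((0 , 0) ∷ (0 , 1) ∷ (0 , 2) ∷ (1 , 0) ∷ (1 , 1) ∷ (2 , 1) ∷ []) ∷
  config 8 ((0 , 0) ∷ (0 , 1) ∷ (0 , 2) ∷ (1 , 0) ∷ (1 , 1) ∷ (2 , 2) ∷ []) ∷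
  config 8 ((0 , 0) ∷ (0 , 1) ∷ (0 , 2) ∷ (1 , 1) ∷ (1 , 2) ∷ (1 , 3) ∷ []) ∷
  config 8 ((0 , 0) ∷ (0 , 1) ∷ (0 , 2) ∷ (1 , 1) ∷ (1 , 2) ∷ (2 , 0) ∷ []) ∷
  config 8 ((0 , 0) ∷ (0 , 1) ∷ (0 , 2) ∷ (1 , 1) ∷ (1 , 2) ∷ (2 , 1) ∷ []) ∷
  config 8 ((0 , 0) ∷ (0 , 1) ∷ (0 , 2) ∷ (1 , 1) ∷ (1 , 3) ∷ (2 , 2) ∷ []) ∷
  config 8 ((0 , 0) ∷ (0 , 2) ∷ (1 , 1) ∷ (1 , 3) ∷ (2 , 1) ∷ (2 , 2) ∷ []) ∷
  config 8 ((0 , 0) ∷ (1 , 0) ∷ (1 , 1) ∷ (2 , 0) ∷ (2 , 1) ∷ (3 , 1) ∷ []) ∷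
  config 8 ((0 , 0) ∷ (1 , 0) ∷ (1 , 1) ∷ (2 , 0) ∷ (2 , 2) ∷ (3 , 1) ∷ []) ∷
  config 8 ((0 , 0) ∷ (1 , 1) ∷ (1 , 2) ∷ (2 , 0) ∷ (2 , 2) ∷ (3 , 1) ∷ []) ∷ []

table₇ : List Configuration
table₇ =
  config 15 ((0 , 0) ∷ (0 , 1) ∷ (0 , 2) ∷ (1 , 0) ∷ (1 , 1) ∷ (1 , 2) ∷ (2 , 1) ∷ []) ∷
  config 15 ((0 , 0) ∷ (0 , 2) ∷ (1 , 1) ∷ (1 , 2) ∷ (1 , 3) ∷ (2 , 0) ∷ (2 , 2) ∷ []) ∷
  config 14 ((0 , 0) ∷ (0 , 1) ∷ (0 , 2) ∷ (1 , 0) ∷ (1 , 1) ∷ (2 , 0) ∷ (2 , 2) ∷ []) ∷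
  config 14 ((0 , 0) ∷ (0 , 1) ∷ (0 , 2) ∷ (1 , 1) ∷ (1 , 2) ∷ (1 , 3) ∷ (2 , 2) ∷ []) ∷
  config 14 ((0 , 0) ∷ (0 , 1) ∷ (0 , 2) ∷ (1 , 1) ∷ (1 , 3) ∷ (2 , 0) ∷ (2 , 2) ∷ []) ∷
  config 14 ((0 , 0) ∷ (0 , 1) ∷ (1 , 0) ∷ (1 , 1) ∷ (1 , 2) ∷ (2 , 1) ∷ (2 , 2) ∷ []) ∷
  config 14 ((0 , 0) ∷ (0 , 2) ∷ (1 , 0) ∷ (1 , 1) ∷ (2 , 0) ∷ (2 , 2) ∷ (3 , 1) ∷ []) ∷
  config 14 ((0 , 0) ∷ (0 , 2) ∷ (1 , 1) ∷ (1 , 2) ∷ (1 , 3) ∷ (2 , 1) ∷ (2 , 2) ∷ []) ∷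
  config 14 ((0 , 0) ∷ (1 , 0) ∷ (1 , 1) ∷ (2 , 0) ∷ (2 , 1) ∷ (2 , 2) ∷ (3 , 1) ∷ []) ∷
  config 14 ((0 , 0) ∷ (1 , 1) ∷ (1 , 2) ∷ (2 , 0) ∷ (2 , 1) ∷ (2 , 2) ∷ (3 , 1) ∷ []) ∷
  config 14 ((0 , 1) ∷ (1 , 0) ∷ (1 , 1) ∷ (1 , 2) ∷ (2 , 1) ∷ (2 , 3) ∷ (3 , 2) ∷ []) ∷
  config 13 ((0 , 0) ∷ (0 , 1) ∷ (0 , 2) ∷ (1 , 0) ∷ (1 , 1) ∷ (1 , 2) ∷ (2 , 0) ∷ []) ∷
  config 13 ((0 , 0) ∷ (0 , 1) ∷ (0 , 2) ∷ (1 , 0) ∷ (1 , 1) ∷ (1 , 2) ∷ (2 , 2) ∷ []) ∷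
  config 13 ((0 , 0) ∷ (0 , 1) ∷ (0 , 2) ∷ (1 , 1) ∷ (2 , 0) ∷ (2 , 2) ∷ (3 , 1) ∷ []) ∷
  config 13 ((0 , 0) ∷ (0 , 1) ∷ (0 , 3) ∷ (1 , 0) ∷ (1 , 1) ∷ (1 , 2) ∷ (2 , 1) ∷ []) ∷
  config 13 ((0 , 0) ∷ (0 , 1) ∷ (1 , 0) ∷ (1 , 1) ∷ (1 , 2) ∷ (2 , 1) ∷ (2 , 3) ∷ []) ∷
  config 13 ((0 , 0) ∷ (0 , 1) ∷ (1 , 0) ∷ (1 , 1) ∷ (1 , 2) ∷ (2 , 1) ∷ (3 , 0) ∷ []) ∷
  config 13 ((0 , 0) ∷ (0 , 1) ∷ (1 , 0) ∷ (1 , 1) ∷ (1 , 2) ∷ (2 , 1) ∷ (3 , 2) ∷ []) ∷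
  config 13 ((0 , 0) ∷ (0 , 2) ∷ (0 , 4) ∷ (1 , 1) ∷ (1 , 2) ∷ (1 , 3) ∷ (2 , 2) ∷ []) ∷
  config 13 ((0 , 0) ∷ (0 , 2) ∷ (1 , 1) ∷ (1 , 2) ∷ (1 , 3) ∷ (2 , 2) ∷ (3 , 1) ∷ []) ∷
  config 13 ((0 , 0) ∷ (1 , 1) ∷ (1 , 3) ∷ (2 , 0) ∷ (2 , 1) ∷ (2 , 2) ∷ (3 , 1) ∷ []) ∷
  config 13 ((0 , 1) ∷ (0 , 2) ∷ (1 , 0) ∷ (1 , 1) ∷ (1 , 2) ∷ (1 , 3) ∷ (2 , 1) ∷ []) ∷
  config 13 ((0 , 1) ∷ (0 , 2) ∷ (1 , 0) ∷ (1 , 1) ∷ (1 , 2) ∷ (1 , 3) ∷ (2 , 2) ∷ []) ∷ []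

table₈ : List Configuration
table₈ =
  config 20 ((0 , 0) ∷ (0 , 1) ∷ (0 , 2) ∷ (1 , 0) ∷ (1 , 1) ∷ (1 , 2) ∷ (2 , 0) ∷ (2 , 1) ∷ []) ∷
  config 20 ((0 , 0) ∷ (0 , 1) ∷ (0 , 2) ∷ (1 , 1) ∷ (1 , 2) ∷ (1 , 3) ∷ (2 , 0) ∷ (2 , 2) ∷ []) ∷
  config 20 ((0 , 0) ∷ (0 , 2) ∷ (1 , 0) ∷ (1 , 1) ∷ (2 , 0) ∷ (2 , 1) ∷ (2 , 2) ∷ (3 , 1) ∷ []) ∷
  config 20 ((0 , 0) ∷ (0 , 2) ∷ (1 , 1) ∷ (1 , 2) ∷ (1 , 3) ∷ (2 , 0) ∷ (2 , 2) ∷ (3 , 1) ∷ []) ∷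
  config 20 ((0 , 0) ∷ (0 , 2) ∷ (1 , 1) ∷ (1 , 3) ∷ (2 , 0) ∷ (2 , 1) ∷ (2 , 2) ∷ (3 , 1) ∷ []) ∷
  config 20 ((0 , 1) ∷ (0 , 2) ∷ (1 , 0) ∷ (1 , 1) ∷ (1 , 2) ∷ (1 , 3) ∷ (2 , 1) ∷ (2 , 2) ∷ []) ∷
  config 20 ((0 , 1) ∷ (1 , 0) ∷ (1 , 1) ∷ (1 , 2) ∷ (2 , 1) ∷ (2 , 2) ∷ (2 , 3) ∷ (3 , 2) ∷ []) ∷ []


-- table n contains, up to similarity, every set of n points that has no isolated point
-- and at least threshold n triangles.
table : ℕ → List Configuration
table 3 = table₃
table 4 = table₄
table 5 = table₅
table 6 = table₆
table 7 = table₇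
table 8 = table₈
table _ = []

-- The thresholds start above the claimed maximum for 9 points and go down so that the
-- deletion of a point of minimal degree from threshold (suc n) triangles leaves threshold n.
threshold maximum : ℕ → ℕ
threshold 3 = 1
threshold 4 = 2
threshold 5 = 4
threshold 6 = 8
threshold 7 = 13
threshold 8 = 20
threshold 9 = 29
threshold _ = 0
maximum 3 = 1
maximum 4 = 4
maximum 5 = 8
maximum 6 = 11
maximum 7 = 15
maximum 8 = 20
maximum 9 = 28
maximum _ = 0

record Covered (n : ℕ) : Set where
  constructor covering
  field
    all-covered : all (covers (threshold (suc n)) (table (suc n))) (table n) ≡ true

-- Here `refl` is the exhaustive search: it tests every candidate point for every entry of the
-- table.
covered₃ : Covered 3
covered₃ = covering refl

covered₄ : Covered 4
covered₄ = covering refl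

covered₅ : Covered 5
covered₅ = covering refl

covered₆ : Covered 6
covered₆ = covering refl

covered₇ : Covered 7
covered₇ = covering refl

covered₈ : Covered 8
covered₈ = covering refl

-- Locating a point set in the tables

Pointwise-↭ : ∀ {A B : Set} {R : A → B → Set} {xs ys zs} → Pointwise R xs ys → ys ↭ zs →
              ∃[ ws ] xs ↭ ws × Pointwise R ws zs
Pointwise-↭ r             _↭_.refl     = _ , ↭-refl , r
Pointwise-↭ (h ∷ r)       (prep y p)   with Pointwise-↭ r p
... | ws , q , r′ = _ , prep _ q , h ∷ r′
Pointwise-↭ (h ∷ h′ ∷ r)  (swap x y p) with Pointwise-↭ r p
... | ws , q , r′ = _ , swap _ _ q , h′ ∷ h ∷ r′
Pointwise-↭ r             (trans p p′) with Pointwise-↭ r p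
... | ws , q , r′ with Pointwise-↭ r′ p′
... | ws′ , q′ , r″ = ws′ , trans q q′ , r″

count₁-++ : ∀ {A : Set} (P : A → Bool) xs ys → count₁ P (xs ++ ys) ≡ count₁ P xs ℕ.+ count₁ P ys
count₁-++ P []       ys = refl
count₁-++ P (x ∷ xs) ys = ≡.trans (cong (toℕ (P x) ℕ.+_) (count₁-++ P xs ys))
  (sym (ℕₚ.+-assoc (toℕ (P x)) _ _))

∈⇒multiplicity : ∀ {c ds} → c ∈ ds → 1 ℕ.≤ multiplicity c ds
∈⇒multiplicity {c} {d ∷ ds} (here refl) =
  subst (λ b → 1 ℕ.≤ toℕ b ℕ.+ multiplicity c ds) (sym (dec-true (c ≟ c) refl)) (s≤s z≤n)
∈⇒multiplicity {c} {d ∷ ds} (there c∈) = ℕₚ.≤-trans (∈⇒multiplicity c∈) (ℕₚ.m≤n+m _ (toℕ (c ≡ᶜ d)))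

module Locations {A : Set} (p : A → ℝ²) (p-injective : ∀ {x y} → p x ≈ p y → x ≡ y)
  (triangle : A → A → A → Bool)
  (triangle-swap₁₂ : ∀ x y z → triangle x y z ≡ triangle y x z)
  (triangle-swap₂₃ : ∀ x y z → triangle x y z ≡ triangle x z y)
  (triangle-rots : ∀ x y z → triangle x y z ≡ true → ¬ ¬ Rots (p x) (p y) (p z))
  where

  open Triangles triangle triangle-swap₁₂ triangle-swap₂₃ public

  Coordinates : ℝ² → ℝ² → List A → List ℤ[i] → Set
  Coordinates a u = Pointwise (λ x c → At a u c (p x))

  record Placed (xs : List A) (cs : List ℤ[i]) : Set where
    constructor placed
    field
      origin unit : ℝ²
      faithful    : Faithful unit
      coordinates : Coordinates origin unit xs cs

  record Realised (xs : List A) (C : Configuration) : Set where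
    constructor realised
    field
      {order} : List A
      order↭  : order ↭ xs
      place   : Placed order (points C)
      size≥   : triangles xs ℕ.≤ size C

  -- Which configuration of the table is realised depends on equalities between real
  -- numbers, hence the double negation.
  Found : ℕ → List A → Set
  Found n xs = ¬ ¬ Any (Realised xs) (table n)

  Found-↭ : ∀ {n xs ys} → xs ↭ ys → Found n xs → Found n ys
  Found-↭ p found k = found λ r → k (Any.map
    (λ (realised q pl s) → realised (trans q p) pl (subst (ℕ._≤ _) (triangles-↭ p) s)) r)

  -- An inequality of natural numbers is decidable, hence stable, and so the double negation in
  -- `Found` is dropped here.
  found-bounded : ∀ {n m} → All (λ C → size C ℕ.≤ m) (table n) →
                  ∀ {xs} → Found n xs → triangles xs ℕ.≤ m
  found-bounded {m = m} sizes {xs} found = decidable-stable (triangles xs ℕₚ.≤? m) λ k →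
    found λ r → let C , C∈ , realised _ _ s = find r in
      k (ℕₚ.≤-trans s (All.lookup sizes C∈))

  module _ {a u : ℝ²} (f : Faithful u) (v : A) where

    third-located : ∀ {y z c d} → triangle v y z ≡ true → At a u c (p y) → At a u d (p z) →
                    ¬ ¬ Any (λ e → At a (/1+i u) e (p v)) (thirds c d)
    third-located {y} {z} {c} {d} t yᶜ zᶜ k = triangle-rots v y z t λ
      { (inj₁ (inj₁ h))        → k (there (there (there (there (here
          (third-at hypotenuse yᶜ zᶜ (hypotenuse-solves h)))))))
      ; (inj₁ (inj₂ h))        → k (there (there (there (there (there (here
          (third-at hypotenuse zᶜ yᶜ (hypotenuse-solves h))))))))
      ; (inj₂ (inj₁ (inj₁ h))) → k (here
          (third-at anticlockwise yᶜ zᶜ (anticlockwise-solves h)))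
      ; (inj₂ (inj₁ (inj₂ h))) → k (there (there (here
          (third-at clockwise yᶜ zᶜ (clockwise-solves h)))))
      ; (inj₂ (inj₂ (inj₁ h))) → k (there (there (there (here
          (third-at clockwise zᶜ yᶜ (clockwise-solves h))))))
      ; (inj₂ (inj₂ (inj₂ h))) → k (there (here
          (third-at anticlockwise zᶜ yᶜ (anticlockwise-solves h))))
      }

    candidate₁ : ∀ {y ys c cs} → At a u c (p y) → Coordinates a u ys cs → 1 ℕ.≤ codegree v y ys →
                 ¬ ¬ Any (λ e → At a (/1+i u) e (p v)) (concatMap (thirds c) cs)
    candidate₁ {y} {z ∷ ys} {c} {d ∷ cs} yᶜ (zᶜ ∷ coords) 1≤ k with triangle v y z in eq
    ... | true  = third-located eq yᶜ zᶜ λ r → k (++⁺ˡ r)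
    ... | false = candidate₁ yᶜ coords 1≤ λ r → k (++⁺ʳ (thirds c d) r)

    candidate₂ : ∀ {ys cs} → Coordinates a u ys cs → 1 ℕ.≤ degree v ys →
                 ¬ ¬ Any (λ e → At a (/1+i u) e (p v)) (candidates cs)
    candidate₂ {y ∷ ys} {c ∷ cs} (yᶜ ∷ coords) 1≤ k with codegree v y ys in eq
    ... | suc _ = candidate₁ yᶜ coords (subst (1 ℕ.≤_) (sym eq) (s≤s z≤n)) λ r → k (++⁺ˡ r)
    ... | zero  = candidate₂ coords 1≤ λ r → k (++⁺ʳ (concatMap (thirds c) cs) r)

    module _ {e : ℤ[i]} (vᶜ : At a (/1+i u) e (p v)) where

      -- Each triangle at `v` yields a candidate that is a coordinate of `v`, and by faithfulness
      -- this is always the same `e`. Different pairs contribute different segments of the candidate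
      -- list, so summing this bound over pairs compares the degree with a multiplicity.
      bound₀ : ∀ {y z c d} → At a u c (p y) → At a u d (p z) →
               toℕ (triangle v y z) ℕ.≤ multiplicity e (thirds c d)
      bound₀ {y} {z} {c} {d} yᶜ zᶜ with triangle v y z in eq
      ... | false = z≤n
      ... | true  = decidable-stable (1 ℕₚ.≤? multiplicity e (thirds c d)) λ k →
        third-located eq yᶜ zᶜ λ r → let e′ , e′∈ , vᶜ′ = find r in
          k (∈⇒multiplicity (subst (_∈ thirds c d)
            (at-unique {a} {/1+i u} {x = p v} (faithful-rescale f) vᶜ′ vᶜ) e′∈))

      bound₁ : ∀ {y ys c cs} → At a u c (p y) → Coordinates a u ys cs →
               codegree v y ys ℕ.≤ multiplicity e (concatMap (thirds c) cs)
      bound₁ yᶜ []                                     = z≤n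
      bound₁ {c = c} {d ∷ cs} yᶜ (zᶜ ∷ coords) = ℕₚ.≤-trans
        (ℕₚ.+-mono-≤ (bound₀ yᶜ zᶜ) (bound₁ yᶜ coords))
        (ℕₚ.≤-reflexive (sym (count₁-++ (e ≡ᶜ_) (thirds c d) (concatMap (thirds c) cs))))

      bound₂ : ∀ {ys cs} → Coordinates a u ys cs → degree v ys ℕ.≤ multiplicity e (candidates cs)
      bound₂ []                                 = z≤n
      bound₂ {cs = c ∷ cs} (yᶜ ∷ coords) = ℕₚ.≤-trans
        (ℕₚ.+-mono-≤ (bound₁ yᶜ coords) (bound₂ coords))
        (ℕₚ.≤-reflexive (sym (count₁-++ (e ≡ᶜ_) (concatMap (thirds c) cs) (candidates cs))))

  rescale : ∀ {a u xs cs} → Coordinates a u xs cs → Coordinates a (/1+i u) xs (map (_⊠ 1+i) cs)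
  rescale []              = []
  rescale (xᶜ ∷ coords) = rescale-at xᶜ ∷ rescale coords

  transform-placed : ∀ {xs cs ds} → Similar cs ds → Placed xs ds → ∃[ ys ] xs ↭ ys × Placed ys cs
  transform-placed {cs = cs} (similar (factor α κ κα≡2) β image) (placed a u f coords)
    with Pointwise-↭ coords (↭-sym image)
  ... | ys , q , coords′ = ys , q , placed _ _ (faithful-• α κ κα≡2 f) (go cs coords′)
    where
    go : ∀ cs {ys} → Coordinates a u ys (transform α β cs) → Coordinates (a ⊕ β • u) (α • u) ys cs
    go []       []              = []
    go (c ∷ cs) (xᶜ ∷ coords) = substitute-at α β c xᶜ ∷ go cs coords

  -- Justifies that `accepts` passes over candidates among the old coordinates: they would put the
  -- new point on an old one, against `Unique`.
  old-point : ∀ {a u c x ys cs} → Coordinates a u ys cs → c ∈ cs → At a u c (p x) → x ∈ ys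
  old-point (yᶜ ∷ coords) (here refl) xᶜ = here (p-injective (unwrap (≋-trans xᶜ (≋-sym yᶜ))))
  old-point (_ ∷ coords)   (there c∈)    xᶜ = there (old-point coords c∈ xᶜ)

  -- `size C` bounds the triangles within `ys`, and the multiplicity of the coordinate of `v` bounds
  -- its degree. The search sees only the sum of these bounds, so it cannot dismiss `v ∷ ys` as
  -- having too few triangles.
  extend : ∀ {n} → Covered n → ∀ v ys → Unique (v ∷ ys) → Found n ys → 1 ℕ.≤ degree v ys →
           threshold (suc n) ℕ.≤ triangles (v ∷ ys) → Found (suc n) (v ∷ ys)
  extend {n} covered v ys uniq found 1≤ t≤ k = found λ r →
    let C , C∈ , realised {zs} zs↭ys (placed a u f coords) size≥ = find r
        degree≡ = degree-↭ v zs↭ys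
    in candidate₂ f v coords (subst (1 ℕ.≤_) (sym degree≡) 1≤) λ r′ →
    let e , e∈ , vᶜ = find r′
        degree≤ : degree v ys ℕ.≤ multiplicity e (candidates (points C))
        degree≤ = ℕₚ.≤-trans (ℕₚ.≤-reflexive (sym degree≡)) (bound₂ f v vᶜ coords)
        sizes≤ : triangles (v ∷ ys) ℕ.≤ size C ℕ.+ multiplicity e (candidates (points C))
        sizes≤ = ℕₚ.≤-trans (ℕₚ.+-mono-≤ degree≤ size≥) (ℕₚ.≤-reflexive (ℕₚ.+-comm _ (size C)))
    in conclude (accepts-sound (threshold (suc n)) (table (suc n)) (size C)
         (map (_⊠ 1+i) (points C)) (candidates (points C))
         (All.lookup (all⁺ _ (table n) (subst T (sym (Covered.all-covered covered)) _)) C∈)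
         e (∈⇒multiplicity e∈) (ℕₚ.≤-trans t≤ sizes≤))
         zs↭ys f coords vᶜ sizes≤
    where
    conclude : ∀ {a u zs cs e s} →
               e ∈ map (_⊠ 1+i) cs ⊎ Extends (table (suc n)) s (e ∷ map (_⊠ 1+i) cs) →
              zs ↭ ys → Faithful u → Coordinates a u zs cs → At a (/1+i u) e (p v) →
              triangles (v ∷ ys) ℕ.≤ s → ⊥
    conclude (inj₁ old) zs↭ys f coords vᶜ _ =
      All.lookup (AllPairs.head uniq)
        (∈-resp-↭ zs↭ys (old-point (rescale coords) old vᶜ)) refl
    conclude (inj₂ new) zs↭ys f coords vᶜ sizes≤ = k (Any.map
      (λ (s≤ , sim) → let ws , q , pl = transform-placed sim
                            (placed _ _ (faithful-rescale f) (vᶜ ∷ rescale coords)) in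
        realised (trans (↭-sym q) (prep v zs↭ys)) pl (ℕₚ.≤-trans sizes≤ s≤)) new)

  -- With the right angle as origin and the leg from which the anticlockwise turn starts as unit,
  -- the coordinates are always `0`, `1`, `i`, as in `table₃`. The six cases differ only in the
  -- order of the points.
  found₃ : ∀ {x y z} → x ≢ y → x ≢ z → y ≢ z → triangle x y z ≡ true → Found 3 (x ∷ y ∷ z ∷ [])
  found₃ {x} {y} {z} x≢y x≢z y≢z t k = triangle-rots x y z t λ
    { (inj₁ (inj₁ h))        → place x≢y h ↭-refl
    ; (inj₁ (inj₂ h))        → place x≢z h (prep x (swap z y ↭-refl))
    ; (inj₂ (inj₁ (inj₁ h))) → place y≢z h (trans (prep y (swap z x ↭-refl)) (swap y x ↭-refl))
    ; (inj₂ (inj₁ (inj₂ h))) → place (x≢y ∘ sym) h (swap y x ↭-refl)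
    ; (inj₂ (inj₂ (inj₁ h))) → place (x≢z ∘ sym) h (trans (swap z x ↭-refl) (prep x (swap z y ↭-refl)))
    ; (inj₂ (inj₂ (inj₂ h))) → place (y≢z ∘ sym) h
        (trans (swap z y ↭-refl) (trans (prep y (swap z x ↭-refl)) (swap y x ↭-refl)))
    }
    where
    place : ∀ {a b c} → a ≢ b → Rot (p a) (p b) (p c) → a ∷ b ∷ c ∷ [] ↭ x ∷ y ∷ z ∷ [] → ⊥
    place {a} {b} {c} a≢b rot q = k (here (realised q
      (placed (p a) (p a ⟶ p b) (faithful-difference (p a) (p b) (a≢b ∘ p-injective))
        (frame-origin (p a) (p b) ∷ frame-unit (p a) (p b) ∷ frame-𝕚 rot ∷ []))
      (ℕₚ.≤-reflexive (cong (λ b → toℕ b ℕ.+ 0 ℕ.+ 0 ℕ.+ 0) t))))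

-- Upper bounds

private variable A : Set

pairs : List A → List (A × A)
pairs []       = []
pairs (x ∷ xs) = map (x ,_) xs ++ pairs xs

triples : List A → List (A × A × A)
triples []       = []
triples (x ∷ xs) = map (x ,_) (pairs xs) ++ triples xs

count₁-map : ∀ {B : Set} (P : B → Bool) (f : A → B) xs → count₁ P (map f xs) ≡ count₁ (P ∘ f) xs
count₁-map P f []       = refl
count₁-map P f (x ∷ xs) = cong (toℕ (P (f x)) ℕ.+_) (count₁-map P f xs)

count₁-pairs : ∀ (R : A → A → Bool) xs → count₁ (λ (x , y) → R x y) (pairs xs) ≡ count₂ R xs
count₁-pairs R []       = refl
count₁-pairs R (x ∷ xs) = ≡.trans (count₁-++ _ (map (x ,_) xs) (pairs xs))
  (cong₂ ℕ._+_ (count₁-map _ (x ,_) xs) (count₁-pairs R xs))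

count₁-triples : ∀ (T : A → A → A → Bool) xs →
                 count₁ (λ (x , y , z) → T x y z) (triples xs) ≡ count₃ T xs
count₁-triples T []       = refl
count₁-triples T (x ∷ xs) = ≡.trans (count₁-++ _ (map (x ,_) (pairs xs)) (triples xs))
  (cong₂ ℕ._+_ (≡.trans (count₁-map _ (x ,_) (pairs xs)) (count₁-pairs (T x) xs)) (count₁-triples T xs))

unique-count : ∀ (P : A → Bool) {ts} us → Unique ts → (∀ {t} → t ∈ ts → t ∈ us × P t ≡ true) →
               length ts ℕ.≤ count₁ P us
unique-count P us [] h = z≤n
unique-count P {t ∷ ts} us (t∉ ∷ uniq) h with ∈⇒↭ (proj₁ (h (here refl)))
... | us′ , p = subst (suc (length ts) ℕ.≤_) (sym (count₁-↭ P p))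
  (subst (λ b → suc (length ts) ℕ.≤ toℕ b ℕ.+ count₁ P us′) (sym (proj₂ (h (here refl))))
    (s≤s (unique-count P us′ uniq λ t′∈ →
      remaining (All.lookup t∉ t′∈) (∈-resp-↭ p (proj₁ (h (there t′∈)))) , proj₂ (h (there t′∈)))))
  where
  remaining : ∀ {t′} → t ≢ t′ → t′ ∈ t ∷ us′ → t′ ∈ us′
  remaining t≢t′ (here eq)   = contradiction (sym eq) t≢t′
  remaining t≢t′ (there t′∈) = t′∈

module _ {n : ℕ} where

  infix 4 _<_
  _<_ : Fin n → Fin n → Set
  _<_ = Fin._<_

  Increasing : List (Fin n) → Set
  Increasing = AllPairs _<_

  below : ∀ {i j k xs} → i < j → All (k <_) xs → i ∈ k ∷ xs → j ∈ k ∷ xs → j ∈ xs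
  below i<j k< (here refl) (here refl) = contradiction i<j (Finₚ.<-irrefl refl)
  below i<j k< (there i∈)  (here refl) = contradiction i<j (Finₚ.<-asym (All.lookup k< i∈))
  below i<j k< _           (there j∈)  = j∈

  pairs-complete : ∀ {xs j k} → Increasing xs → j < k → j ∈ xs → k ∈ xs → (j , k) ∈ pairs xs
  pairs-complete {x ∷ xs} (x< ∷ inc) j<k j∈@(here refl) k∈ = ∈-++⁺ˡ (∈-map⁺ (x ,_) (below j<k x< j∈ k∈))
  pairs-complete {x ∷ xs} (x< ∷ inc) j<k j∈@(there j∈′) k∈ =
    ∈-++⁺ʳ (map (x ,_) xs) (pairs-complete inc j<k j∈′ (below j<k x< j∈ k∈))

  triples-complete : ∀ {xs i j k} → Increasing xs → i < j → j < k → i ∈ xs → j ∈ xs → k ∈ xs →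
                     (i , j , k) ∈ triples xs
  triples-complete {x ∷ xs} (x< ∷ inc) i<j j<k i∈@(here refl) j∈ k∈ = ∈-++⁺ˡ (∈-map⁺ (x ,_)
    (pairs-complete inc j<k (below i<j x< i∈ j∈) (below j<k x< j∈ k∈)))
  triples-complete {x ∷ xs} (x< ∷ inc) i<j j<k i∈@(there i∈′) j∈ k∈ =
    ∈-++⁺ʳ (map (x ,_) (pairs xs))
      (triples-complete inc i<j j<k i∈′ (below i<j x< i∈ j∈) (below j<k x< j∈ k∈))

  pairs-∈ : ∀ {xs j k} → Increasing xs → (j , k) ∈ pairs xs → j ∈ xs × j < k
  pairs-∈ {x ∷ xs} (x< ∷ inc) jk∈ with ∈-++⁻ (map (x ,_) xs) jk∈
  ... | inj₁ h with ∈-map⁻ (x ,_) h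
  ... | _ , k∈ , refl = here refl , All.lookup x< k∈
  pairs-∈ {x ∷ xs} (x< ∷ inc) jk∈ | inj₂ h with pairs-∈ inc h
  ... | j∈ , j<k = there j∈ , j<k

  triples-∈ : ∀ {xs i j k} → Increasing xs → (i , j , k) ∈ triples xs → i ∈ xs × i < j × j < k
  triples-∈ {x ∷ xs} (x< ∷ inc) ijk∈ with ∈-++⁻ (map (x ,_) (pairs xs)) ijk∈
  ... | inj₁ h with ∈-map⁻ (x ,_) h
  ... | _ , jk∈ , refl with pairs-∈ inc jk∈
  ... | j∈ , j<k = here refl , All.lookup x< j∈ , j<k
  triples-∈ {x ∷ xs} (x< ∷ inc) ijk∈ | inj₂ h with triples-∈ inc h
  ... | i∈ , i<j , j<k = there i∈ , i<j , j<k

  Increasing⇒Unique : ∀ {xs} → Increasing xs → Unique xs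
  Increasing⇒Unique = AllPairs.map λ i<j i≡j → Finₚ.<-irrefl i≡j i<j

  pairs-unique : ∀ {xs} → Increasing xs → Unique (pairs xs)
  pairs-unique [] = []
  pairs-unique {x ∷ xs} (x< ∷ inc) = Uniqueₚ.++⁺
    (Uniqueₚ.map⁺ ,-injectiveʳ (Increasing⇒Unique inc)) (pairs-unique inc) λ (l , r) → disjoint l r
    where
    disjoint : ∀ {t} → t ∈ map (x ,_) xs → ¬ t ∈ pairs xs
    disjoint l r with ∈-map⁻ (x ,_) l
    ... | _ , _ , refl = Finₚ.<-irrefl refl (All.lookup x< (proj₁ (pairs-∈ inc r)))

  triples-unique : ∀ {xs} → Increasing xs → Unique (triples xs)
  triples-unique [] = []
  triples-unique {x ∷ xs} (x< ∷ inc) = Uniqueₚ.++⁺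
    (Uniqueₚ.map⁺ ,-injectiveʳ (pairs-unique inc)) (triples-unique inc) λ (l , r) → disjoint l r
    where
    disjoint : ∀ {t} → t ∈ map (x ,_) (pairs xs) → ¬ t ∈ triples xs
    disjoint l r with ∈-map⁻ (x ,_) l
    ... | _ , _ , refl = Finₚ.<-irrefl refl (All.lookup x< (proj₁ (triples-∈ inc r)))

allFin-increasing : ∀ n → Increasing (allFin n)
allFin-increasing n = AllPairsₚ.tabulate⁺-< λ i<j → i<j

-- The induction over the sizes from 4 to 9

record Level (k : ℕ) : Set where
  field
    thresholds : Thresholds (suc k) (threshold (3 ℕ.+ k)) (threshold (4 ℕ.+ k))
                   (maximum (2 ℕ.+ k)) (maximum (3 ℕ.+ k)) (maximum (4 ℕ.+ k))
    covered    : Covered (3 ℕ.+ k)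
    sizes      : All (λ C → size C ℕ.≤ maximum (4 ℕ.+ k)) (table (4 ℕ.+ k))

mkThresholds : ∀ {k t m₁ m₂ m₃} gap →
  {True (3 ℕ.* t ℕₚ.<? k ℕ.* suc gap ℕ.+ 3)} → {True (m₁ ℕ.+ suc k ℕₚ.≤? t ℕ.+ gap)} →
  {True (3 ℕ.* m₁ ℕₚ.<? suc k ℕ.* suc k)} → {True (m₂ ℕₚ.≤? m₃)} → {True (t ℕ.+ gap ℕₚ.≤? suc m₃)} →
  Thresholds k t (t ℕ.+ gap) m₁ m₂ m₃
mkThresholds gap {keep} {full} {thin} {mono} {beyond} = record
  { gap = gap ; t′≡ = refl ; keep = toWitness keep ; full = toWitness full
  ; thin = toWitness thin ; mono = toWitness mono ; beyond = toWitness beyond }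

table-sizes : ∀ n {m} → {True (All.all? (λ C → size C ℕₚ.≤? m) (table n))} →
        All (λ C → size C ℕ.≤ m) (table n)
table-sizes n {m} {h} = toWitness h

-- The numbers given to `mkThresholds` here and below are the differences of consecutive thresholds.
level₄ : Level 0
level₄ = record { thresholds = mkThresholds 1 ; covered = covered₃ ; sizes = table-sizes 4 }

level₅ : Level 1
level₅ = record { thresholds = mkThresholds 2 ; covered = covered₄ ; sizes = table-sizes 5 }

level₆ : Level 2
level₆ = record { thresholds = mkThresholds 4 ; covered = covered₅ ; sizes = table-sizes 6 }

level₇ : Level 3
level₇ = record { thresholds = mkThresholds 5 ; covered = covered₆ ; sizes = table-sizes 7 }

level₈ : Level 4
level₈ = record { thresholds = mkThresholds 7 ; covered = covered₇ ; sizes = table-sizes 8 }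

-- `table 9` is empty, so `covered₈` says that no extension reaches 29 triangles, and `sizes` holds
-- vacuously for the bound 28.
level₉ : Level 5
level₉ = record { thresholds = mkThresholds 9 ; covered = covered₈ ; sizes = table-sizes 9 }

module UpperBound {n : ℕ} (P : PointSet n) {ts : List (Triple n)}
  (is-triangle : ∀ {t} → t ∈ ts → IsTriangleOf P t) where

  open DecMembership (≡-dec (Finₚ._≟_ {n}) (≡-dec (Finₚ._≟_ {n}) (Finₚ._≟_ {n}))) using (_∈?_)

  orders : Fin n → Fin n → Fin n → List (Triple n)
  orders i j k =
    (i , j , k) ∷ (j , k , i) ∷ (k , i , j) ∷ (j , i , k) ∷ (i , k , j) ∷ (k , j , i) ∷ []

  -- Membership in `ts` is decidable, while being a triangle in the real plane is not. Listing all
  -- six orders makes the relation symmetric, as the counting lemmas require.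
  Spans : Fin n → Fin n → Fin n → Set
  Spans i j k = Any (_∈ ts) (orders i j k)

  spans? : ∀ i j k → Dec (Spans i j k)
  spans? i j k = any? (_∈? ts) (orders i j k)

  spans-swap₁₂ : ∀ {i j k} → Spans i j k → Spans j i k
  spans-swap₁₂ (here h)                                 = there (there (there (here h)))
  spans-swap₁₂ (there (here h))                         = there (there (there (there (here h))))
  spans-swap₁₂ (there (there (here h)))                 = there (there (there (there (there (here h)))))
  spans-swap₁₂ (there (there (there (here h))))         = here h
  spans-swap₁₂ (there (there (there (there (here h))))) = there (here h)
  spans-swap₁₂ (there (there (there (there (there (here h)))))) = there (there (here h))

  spans-swap₂₃ : ∀ {i j k} → Spans i j k → Spans i k j
  spans-swap₂₃ (here h)                                 = there (there (there (there (here h))))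
  spans-swap₂₃ (there (here h))                         = there (there (there (there (there (here h)))))
  spans-swap₂₃ (there (there (here h)))                 = there (there (there (here h)))
  spans-swap₂₃ (there (there (there (here h))))         = there (there (here h))
  spans-swap₂₃ (there (there (there (there (here h))))) = here h
  spans-swap₂₃ (there (there (there (there (there (here h)))))) = there (here h)

  triangle : Fin n → Fin n → Fin n → Bool
  triangle i j k = does (spans? i j k)

  triangle-swap₁₂ : ∀ i j k → triangle i j k ≡ triangle j i k
  triangle-swap₁₂ i j k = does-⇔ (mk⇔ spans-swap₁₂ spans-swap₁₂) (spans? i j k) (spans? j i k)

  triangle-swap₂₃ : ∀ i j k → triangle i j k ≡ triangle i k j
  triangle-swap₂₃ i j k = does-⇔ (mk⇔ spans-swap₂₃ spans-swap₂₃) (spans? i j k) (spans? i k j)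

  p : Fin n → ℝ²
  p = point P

  rots : ∀ {i j k} → (i , j , k) ∈ ts → ¬ ¬ Rots (p i) (p j) (p k)
  rots {i} {j} {k} t∈ = triangle⇒rots (p i) (p j) (p k) (proj₂ (proj₂ (is-triangle t∈)))

  spans-rots : ∀ {i j k} → Spans i j k → ¬ ¬ Rots (p i) (p j) (p k)
  spans-rots (here h) m                                 = rots h m
  spans-rots (there (here h)) m                         = rots h (m ∘ Rots-cycle ∘ Rots-cycle)
  spans-rots (there (there (here h))) m                 = rots h (m ∘ Rots-cycle)
  spans-rots (there (there (there (here h)))) m         = rots h (m ∘ Rots-swap ∘ Rots-cycle)
  spans-rots (there (there (there (there (here h))))) m = rots h (m ∘ Rots-swap)
  spans-rots (there (there (there (there (there (here h)))))) m =
    rots h (m ∘ Rots-cycle ∘ Rots-swap)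

  triangle-rots : ∀ i j k → triangle i j k ≡ true → ¬ ¬ Rots (p i) (p j) (p k)
  triangle-rots i j k t = spans-rots (witness (spans? i j k) t)
    where
    witness : ∀ {A : Set} (d : Dec A) → does d ≡ true → A
    witness (yes a) _ = a

  open Locations p (distinct P) triangle triangle-swap₁₂ triangle-swap₂₃ triangle-rots public

  length≤triangles : Unique ts → length ts ℕ.≤ triangles (allFin n)
  length≤triangles uniq = subst (length ts ℕ.≤_) (count₁-triples triangle (allFin n))
    (unique-count _ (triples (allFin n)) uniq λ {t@(i , j , k)} t∈ →
      let i<j , j<k , _ = is-triangle t∈ in
      triples-complete (allFin-increasing n) i<j j<k (∈-allFin i) (∈-allFin j) (∈-allFin k) ,
      dec-true (spans? i j k) (here t∈))

  located₃ : Located Found 3 1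
  located₃ (x ∷ y ∷ z ∷ []) refl ((x≢y ∷ x≢z ∷ []) ∷ (y≢z ∷ []) ∷ _) _ 1≤ with triangle x y z in t
  ... | true = found₃ x≢y x≢z y≢z t
  ... | false = contradiction 1≤ λ ()

  bounded₂ : Bounded 2 0
  bounded₂ (x ∷ y ∷ []) refl _ = z≤n

  bounded₃ : Bounded 3 1
  bounded₃ (x ∷ y ∷ z ∷ []) refl _ with triangle x y z
  ... | true  = ℕₚ.≤-refl
  ... | false = z≤n

  -- Two consecutive bounds are carried along because the step also needs the one for two points
  -- fewer.
  record Stage (k : ℕ) : Set where
    constructor stage
    field
      bounded-below : Bounded (2 ℕ.+ k) (maximum (2 ℕ.+ k))
      bounded       : Bounded (3 ℕ.+ k) (maximum (3 ℕ.+ k))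
      located       : Located Found (3 ℕ.+ k) (threshold (3 ℕ.+ k))

  next : ∀ {k} → Level k → Stage k → Stage (suc k)
  next {k} level (stage bounded₁ bounded₂ located) = stage bounded₂ bounded-step located-step
    where
    open Level level
    open Step Found Found-↭ thresholds (extend covered) (found-bounded {4 ℕ.+ k} sizes)
      bounded₁ bounded₂ located

  stage₃ : Stage 0
  stage₃ = stage bounded₂ bounded₃ located₃

  stage₄ = next level₄ stage₃
  stage₅ = next level₅ stage₄
  stage₆ = next level₆ stage₅
  stage₇ = next level₇ stage₆
  stage₈ = next level₈ stage₇
  stage₉ = next level₉ stage₈

upper-bound : ∀ {n m} →
  (∀ (P : PointSet n) {ts} (is-triangle : ∀ {t} → t ∈ ts → IsTriangleOf P t) →
    UpperBound.Bounded P is-triangle n m) →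
  ∀ (P : PointSet n) s → S△[ P ]≡ s → s ℕ.≤ m
upper-bound {n} bounded P s (ts , unique , iff , refl) = ℕₚ.≤-trans
  (UpperBound.length≤triangles P is-triangle unique)
  (bounded P is-triangle (allFin n) (length-tabulate _) (Uniqueₚ.allFin⁺ n))
  where
  is-triangle : ∀ {t} → t ∈ ts → IsTriangleOf P t
  is-triangle {t} = Equivalence.to (iff t)

-- Lower bounds

ι² : ℤ[i] → ℝ²
ι² (a , b) = fromℚ (ι a) , fromℚ (ι b)

-- Integer points have constant coordinate sequences, and arithmetic keeps them constant. Equality
-- of such reals reduces to equality of rationals at index 0, so the triangles of a grid can be
-- counted by evaluation.
Constant : ℝ → Set
Constant x = ∀ n → seq x n ≡ seq x 0

constant≃? : ∀ x y → Constant x → Constant y → Dec (x ≃ y)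
constant≃? x y x-const y-const = map′
  (λ eq → ≡⇒≃ {x} {y} λ n → ≡.trans (x-const n) (≡.trans eq (sym (y-const n))))
  (λ x≃y → fromℚ-injective (Null-resp (λ n → cong₂ ℚ._-_ (x-const n) (y-const n)) x≃y))
  (seq x 0 ℚₚ.≟ seq y 0)

module _ (c d e : ℤ[i]) where

  rightAngleAt? : Dec (RightAngleAt (ι² c) (ι² d) (ι² e))
  rightAngleAt? = constant≃? (dot (ι² c ⟶ ι² d) (ι² c ⟶ ι² e)) 0ℝ (λ _ → refl) (λ _ → refl)

  equalSidesAt? : Dec (EqualSidesAt (ι² c) (ι² d) (ι² e))
  equalSidesAt? = constant≃? (dist² (ι² c) (ι² d)) (dist² (ι² c) (ι² e)) (λ _ → refl) (λ _ → refl)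

  collinear? : Dec (Collinear (ι² c) (ι² d) (ι² e))
  collinear? = constant≃? (det (ι² c ⟶ ι² d) (ι² c ⟶ ι² e)) 0ℝ (λ _ → refl) (λ _ → refl)

isoscelesRightTriangle? : ∀ c d e → Dec (IsoscelesRightTriangle (ι² c) (ι² d) (ι² e))
isoscelesRightTriangle? c d e = ¬? (collinear? c d e)
  ×-dec (equalSidesAt? c d e ⊎-dec equalSidesAt? d e c ⊎-dec equalSidesAt? e c d)
  ×-dec (rightAngleAt? c d e ⊎-dec rightAngleAt? d e c ⊎-dec rightAngleAt? e c d)

module Grid {n : ℕ} (cs : Vec ℤ[i] n) where

  injective? : Dec (∀ i j → lookup cs i ≡ lookup cs j → i ≡ j)
  injective? = Finₚ.all? λ i → Finₚ.all? λ j → (lookup cs i ≟ lookup cs j) →-dec (i Finₚ.≟ j)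

  grid : {True injective?} → PointSet n
  grid {inj} = mkPointSet (ι² ∘ lookup cs) λ (h₁ , h₂) → toWitness inj _ _
    (cong₂ _,_ (ι-injective (fromℚ-injective h₁)) (ι-injective (fromℚ-injective h₂)))

  Triangle : Triple n → Set
  Triangle (i , j , k) = IsoscelesRightTriangle (ι² (lookup cs i)) (ι² (lookup cs j)) (ι² (lookup cs k))

  triangle? : ∀ t → Dec (Triangle t)
  triangle? (i , j , k) = isoscelesRightTriangle? (lookup cs i) (lookup cs j) (lookup cs k)

  grid-triangles : List (Triple n)
  grid-triangles = filter triangle? (triples (allFin n))

  attained : ∀ {s} → {True injective?} → length grid-triangles ≡ s → ∃[ P ] S△[_]≡_ {n} P s
  attained {_} {inj} size = grid {inj} , grid-triangles
    , Uniqueₚ.filter⁺ triangle? (triples-unique (allFin-increasing n))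
    , (λ t → mk⇔
        (λ t∈ → let t∈′ , △ = ∈-filter⁻ triangle? t∈
                    _ , i<j , j<k = triples-∈ (allFin-increasing n) t∈′
                in i<j , j<k , △)
        (λ (i<j , j<k , △) → ∈-filter⁺ triangle?
          (triples-complete (allFin-increasing n) i<j j<k (∈-allFin _) (∈-allFin _) (∈-allFin _)) △))
    , size

-- The first n points of this list attain the maximum for every n from 3 to 9.
best : Vec ℤ[i] 9
best = Vec.map (λ (x , y) → + x , + y)
  ((0 , 1) ∷ (1 , 0) ∷ (2 , 1) ∷ (1 , 2) ∷ (1 , 1) ∷ (0 , 0) ∷ (0 , 2) ∷ (2 , 0) ∷ (2 , 2) ∷ [])

theorem5 : (S△⟨ 3 ⟩≡ 1) × (S△⟨ 4 ⟩≡ 4) × (S△⟨ 5 ⟩≡ 8) × (S△⟨ 6 ⟩≡ 11) ×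
    (S△⟨ 7 ⟩≡ 15) × (S△⟨ 8 ⟩≡ 20) × (S△⟨ 9 ⟩≡ 28)
theorem5 =
  (Grid.attained (Vec.take 3 best) refl , upper-bound λ P h → bounded (stage₃ P h)) ,
  (Grid.attained (Vec.take 4 best) refl , upper-bound λ P h → bounded (stage₄ P h)) ,
  (Grid.attained (Vec.take 5 best) refl , upper-bound λ P h → bounded (stage₅ P h)) ,
  (Grid.attained (Vec.take 6 best) refl , upper-bound λ P h → bounded (stage₆ P h)) ,
  (Grid.attained (Vec.take 7 best) refl , upper-bound λ P h → bounded (stage₇ P h)) ,
  (Grid.attained (Vec.take 8 best) refl , upper-bound λ P h → bounded (stage₈ P h)) ,
  (Grid.attained best refl , upper-bound λ P h → bounded (stage₉ P h))
  where
  open UpperBound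
  open UpperBound.Stage using (bounded)
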